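{- Let $A$ be a congruent number and let $C_A$ be the curve $y^2=x^3-A^2x$. If $(x_0,y_0)\in\mathbb{Q}^2$ is a rational point on $C_A$ with $y_0\neq 0$, then $(x_0,y_0)$ has infinite order in the group $(C_A(\mathbb{Q}),+)$. In particular, if there exists one rational Pythagorean $A$-triple, then there exist infinitely many rational Pythagorean $A$-triples.
   Context: A positive integer $A$ is called a congruent number if $A$ is the area of a right-angled triangle with three rational sides, i.e. if there exist $a,b,c\in\mathbb{Q}$ with $a^2+b^2=c^2$, $ab\neq 0$ and $\frac{ab}{2}=A$. For a positive integer $A$, a rational Pythagorean $A$-triple is a triple $(a,b,c)$ of non-zero rational numbers (possibly negative) such that $a^2+b^2=c^2$ and $A=\left|\frac{ab}{2}\right|$. $C_A(\mathbb{Q})$ denotes the set of rational points on $C_A: y^2=x^3-A^2x$ together with the point at infinity $\mathscr{O}$. The operation $+$ is the usual chord-and-tangent abelian group law on this elliptic curve, with neutral element $\mathscr{O}$. -}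

module Defs where

open import Algebra.Bundles using (RawGroup)
import Algebra.Definitions.RawMonoid as RawMonoidDefinitions
import Algebra.Properties.Group as GroupProperties
open import Data.Integer.Base using (+_)
open import Data.Nat.Base as ℕ using (ℕ; suc)
open import Data.Product.Base using (_×_; _,_; ∃; ∃-syntax)
open import Data.Rational.Base
open import Data.Rational.Properties
open import Data.Rational.Solver using (module +-*-Solver)
open import Function.Definitions using (Injective)
open import Level using (0ℓ)
open import Relation.Binary.PropositionalEquality
open import Relation.Nullary using (¬_; yes; no)
open import Relation.Unary using (Pred; _∈_)

open ≡-Reasoning
open +-*-Solver using (solve; _:=_; _:+_; _:*_; _:-_; :-_; con)

fromℕ : ℕ → ℚ
fromℕ n = + n / 1

IsCongruent : ℕ → Set
IsCongruent A = 0 ℕ.< A ×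
  ∃[ a ] ∃[ b ] ∃[ c ]
    (a * a + b * b ≡ c * c) × (a * b ≢ 0ℚ) × (a * b * ½ ≡ fromℕ A)

PythagoreanTriple : ℕ → Pred (ℚ × ℚ × ℚ) 0ℓ
PythagoreanTriple A (a , b , c) =
  (a ≢ 0ℚ) × (b ≢ 0ℚ) × (c ≢ 0ℚ) ×
  (a * a + b * b ≡ c * c) × (fromℕ A ≡ ∣ a * b * ½ ∣)

Infinite : {X : Set} → Pred X 0ℓ → Set
Infinite {X} P = ∃ λ (f : ℕ → X) → Injective _≡_ _≡_ f × (∀ n → f n ∈ P)

HasInfiniteOrder : (G : RawGroup 0ℓ 0ℓ) → RawGroup.Carrier G → Set
HasInfiniteOrder G g = ∀ n → ¬ (suc n · g ≈ ε)
  where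
  open RawGroup G
  open RawMonoidDefinitions rawMonoid using () renaming (_×_ to _·_)

p-q≡0⇒p≡q : ∀ p q → p - q ≡ 0ℚ → p ≡ q
p-q≡0⇒p≡q = GroupProperties.x∙y⁻¹≈ε⇒x≈y +-0-group

p*q≡0∧p≢0⇒q≡0 : ∀ p q → p ≢ 0ℚ → p * q ≡ 0ℚ → q ≡ 0ℚ
p*q≡0∧p≢0⇒q≡0 p q p≢0 pq≡0 = begin
  q               ≡⟨ *-identityˡ q ⟨
  1ℚ * q          ≡⟨ cong (_* q) (*-inverseˡ p) ⟨
  1/ p * p * q    ≡⟨ *-assoc (1/ p) p q ⟩
  1/ p * (p * q)  ≡⟨ cong (1/ p *_) pq≡0 ⟩
  1/ p * 0ℚ       ≡⟨ *-zeroʳ (1/ p) ⟩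
  0ℚ              ∎
  where instance _ = ≢-nonZero p≢0

p÷q*q≡p : ∀ p q .{{_ : NonZero q}} → p ÷ q * q ≡ p
p÷q*q≡p p q = begin
  p * 1/ q * q    ≡⟨ *-assoc p (1/ q) q ⟩
  p * (1/ q * q)  ≡⟨ cong (p *_) (*-inverseˡ q) ⟩
  p * 1ℚ          ≡⟨ *-identityʳ p ⟩
  p               ∎

module CongruentNumberCurve (A : ℕ) where

  A² : ℚ
  A² = fromℕ A * fromℕ A

  OnCurve : ℚ → ℚ → Set
  OnCurve x y = y * y ≡ x * x * x - A² * x

  -- The membership proof is irrelevant, so that points are equal as soon as
  -- their coordinates are; no information is lost, equality on ℚ being decidable.
  data Point : Set where
    𝒪      : Point
    affine : (x y : ℚ) → .(OnCurve x y) → Point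

  -- The line of slope s through (x₁ , y₁) meets the curve in points whose
  -- abscissae sum to s²; the third point of intersection is reflected in the
  -- x-axis.
  thirdX : (s x₁ x₂ : ℚ) → ℚ
  thirdX s x₁ x₂ = s * s - x₁ - x₂

  thirdY : (s x₁ y₁ x₃ : ℚ) → ℚ
  thirdY s x₁ y₁ x₃ = s * (x₁ - x₃) - y₁

  chordSlope : (x₁ y₁ x₂ y₂ : ℚ) → x₁ ≢ x₂ → ℚ
  chordSlope x₁ y₁ x₂ y₂ x₁≢x₂ = (y₂ - y₁) ÷ (x₂ - x₁)
    where instance _ = ≢-nonZero λ eq → x₁≢x₂ (sym (p-q≡0⇒p≡q x₂ x₁ eq))

  tangentSlope : (x y : ℚ) → .(y + y ≢ 0ℚ) → ℚ
  tangentSlope x y 2y≢0 =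
    _÷_ (x * x + x * x + x * x - A²) (y + y) {{≢-nonZero 2y≢0}}

  onCurve⇒0 : ∀ x y → OnCurve x y → x * x * x - A² * x - y * y ≡ 0ℚ
  onCurve⇒0 x y on = trans (cong (λ z → x * x * x - A² * x - z) on)
                           (+-inverseʳ (x * x * x - A² * x))

  negate-onCurve : ∀ x y → OnCurve x y → OnCurve x (- y)
  negate-onCurve x y on =
    trans (solve 1 (λ y → (:- y) :* (:- y) := y :* y) refl y) on

  chord-onCurve : ∀ x₁ y₁ x₂ y₂ s → x₁ ≢ x₂ → s * (x₂ - x₁) ≡ y₂ - y₁ →
                  OnCurve x₁ y₁ → OnCurve x₂ y₂ →
                  OnCurve (thirdX s x₁ x₂) (thirdY s x₁ y₁ (thirdX s x₁ x₂))
  chord-onCurve x₁ y₁ x₂ y₂ s x₁≢x₂ slope on₁ on₂ =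
    sym (p-q≡0⇒p≡q _ _ (p*q≡0∧p≢0⇒q≡0 (x₂ - x₁) _
      (λ eq → x₁≢x₂ (sym (p-q≡0⇒p≡q x₂ x₁ eq))) (begin
        (x₂ - x₁) * (X * X * X - A² * X - Y * Y)
          ≡⟨ solve 6 (λ x₁ y₁ x₂ s X a →
               (x₂ :- x₁) :* (X :* X :* X :- a :* X
                 :- (s :* (x₁ :- X) :- y₁) :* (s :* (x₁ :- X) :- y₁))
               := (x₂ :- X) :* (x₁ :* x₁ :* x₁ :- a :* x₁ :- y₁ :* y₁)
               :+ (X :- x₁) :* (x₂ :* x₂ :* x₂ :- a :* x₂
                    :- (y₁ :+ s :* (x₂ :- x₁)) :* (y₁ :+ s :* (x₂ :- x₁)))
               :+ (x₂ :- x₁) :* ((X :- x₁) :* (X :- x₂)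
                    :* (X :- (s :* s :- x₁ :- x₂))))
               refl x₁ y₁ x₂ s X A² ⟩
        (x₂ - X) * (x₁ * x₁ * x₁ - A² * x₁ - y₁ * y₁)
        + (X - x₁) * (x₂ * x₂ * x₂ - A² * x₂
            - (y₁ + s * (x₂ - x₁)) * (y₁ + s * (x₂ - x₁)))
        + (x₂ - x₁) * ((X - x₁) * (X - x₂) * (X - X))
          ≡⟨ cong₂ (λ u v → (x₂ - X) * u + (X - x₁) * v
               + (x₂ - x₁) * ((X - x₁) * (X - x₂) * (X - X)))
               (onCurve⇒0 x₁ y₁ on₁)
               (trans (cong (λ z → x₂ * x₂ * x₂ - A² * x₂ - z * z) y₁+Δ≡y₂)
                      (onCurve⇒0 x₂ y₂ on₂)) ⟩
        (x₂ - X) * 0ℚ + (X - x₁) * 0ℚ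
        + (x₂ - x₁) * ((X - x₁) * (X - x₂) * (X - X))
          ≡⟨ solve 3 (λ x₁ x₂ X →
               (x₂ :- X) :* con 0ℚ :+ (X :- x₁) :* con 0ℚ
               :+ (x₂ :- x₁) :* ((X :- x₁) :* (X :- x₂) :* (X :- X))
               := con 0ℚ) refl x₁ x₂ X ⟩
        0ℚ ∎)))
    where
    X = thirdX s x₁ x₂
    Y = thirdY s x₁ y₁ X
    y₁+Δ≡y₂ : y₁ + s * (x₂ - x₁) ≡ y₂
    y₁+Δ≡y₂ = trans (cong (λ z → y₁ + z) slope)
      (solve 2 (λ y₁ y₂ → y₁ :+ (y₂ :- y₁) := y₂) refl y₁ y₂)

  tangent-onCurve : ∀ x y s → s * (y + y) ≡ x * x + x * x + x * x - A² →
                    OnCurve x y →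
                    OnCurve (thirdX s x x) (thirdY s x y (thirdX s x x))
  tangent-onCurve x y s slope on = sym (p-q≡0⇒p≡q _ _ (begin
    X * X * X - A² * X - Y * Y
      ≡⟨ solve 5 (λ x y s X a →
           X :* X :* X :- a :* X
             :- (s :* (x :- X) :- y) :* (s :* (x :- X) :- y)
           := (x :* x :* x :- a :* x :- y :* y)
           :+ (X :- x) :* (x :* x :+ x :* x :+ x :* x :- a :- s :* (y :+ y))
           :+ (X :- x) :* (X :- x) :* (X :- (s :* s :- x :- x)))
           refl x y s X A² ⟩
    (x * x * x - A² * x - y * y)
    + (X - x) * (x * x + x * x + x * x - A² - s * (y + y))
    + (X - x) * (X - x) * (X - X)
      ≡⟨ cong₂ (λ u v → u
           + (X - x) * (x * x + x * x + x * x - A² - v)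
           + (X - x) * (X - x) * (X - X))
           (onCurve⇒0 x y on) slope ⟩
    0ℚ + (X - x) * (x * x + x * x + x * x - A² - (x * x + x * x + x * x - A²))
    + (X - x) * (X - x) * (X - X)
      ≡⟨ solve 3 (λ x X a →
           con 0ℚ :+ (X :- x) :* (x :* x :+ x :* x :+ x :* x :- a
                         :- (x :* x :+ x :* x :+ x :* x :- a))
           :+ (X :- x) :* (X :- x) :* (X :- X) := con 0ℚ) refl x X A² ⟩
    0ℚ ∎))
    where
    X = thirdX s x x
    Y = thirdY s x y X

  2y≢0 : ∀ x₁ y₁ x₂ y₂ → OnCurve x₁ y₁ → OnCurve x₂ y₂ →
         x₁ ≡ x₂ → y₁ ≢ - y₂ → y₁ + y₁ ≢ 0ℚ
  2y≢0 x y₁ .x y₂ on₁ on₂ refl y₁≢-y₂ 2y₁≡0 = y₁≢-y₂ (begin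
    y₁           ≡⟨ p-q≡0⇒p≡q y₁ y₂ y₁-y₂≡0 ⟩
    y₂           ≡⟨ solve 2 (λ y₁ y₂ → y₂ :=
                      (y₁ :+ y₁) :- (y₁ :- y₂) :- (y₁ :- y₂) :- y₂) refl y₁ y₂ ⟩
    (y₁ + y₁) - (y₁ - y₂) - (y₁ - y₂) - y₂
                 ≡⟨ cong₂ (λ u v → u - v - v - y₂) 2y₁≡0 y₁-y₂≡0 ⟩
    0ℚ - 0ℚ - 0ℚ - y₂ ≡⟨ +-identityˡ (- y₂) ⟩
    - y₂         ∎)
    where
    y₁-y₂≡0 : y₁ - y₂ ≡ 0ℚ
    y₁-y₂≡0 = p*q≡0∧p≢0⇒q≡0 (y₁ - - y₂) (y₁ - y₂)
      (λ eq → y₁≢-y₂ (p-q≡0⇒p≡q y₁ (- y₂) eq)) (begin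
      (y₁ - - y₂) * (y₁ - y₂)
        ≡⟨ solve 2 (λ y₁ y₂ → (y₁ :- (:- y₂)) :* (y₁ :- y₂)
             := y₁ :* y₁ :- y₂ :* y₂) refl y₁ y₂ ⟩
      y₁ * y₁ - y₂ * y₂  ≡⟨ cong (_- y₂ * y₂) (trans on₁ (sym on₂)) ⟩
      y₂ * y₂ - y₂ * y₂  ≡⟨ +-inverseʳ (y₂ * y₂) ⟩
      0ℚ                 ∎)

  infix  8 ⊖_
  infixl 6 _⊕_

  ⊖_ : Point → Point
  ⊖ 𝒪             = 𝒪
  ⊖ affine x y on = affine x (- y) (negate-onCurve x y on)

  -- On the curve, x₁ ≡ x₂ and y₁ ≢ - y₂ force the two points to coincide, and
  -- y₁ to be nonzero.
  _⊕_ : Point → Point → Point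
  𝒪               ⊕ Q               = Q
  P@(affine _ _ _) ⊕ 𝒪              = P
  affine x₁ y₁ on₁ ⊕ affine x₂ y₂ on₂ with x₁ ≟ x₂ | y₁ ≟ - y₂
  ... | no x₁≢x₂  | _ =
    affine (thirdX s x₁ x₂) (thirdY s x₁ y₁ (thirdX s x₁ x₂))
      (chord-onCurve x₁ y₁ x₂ y₂ s x₁≢x₂
        (p÷q*q≡p (y₂ - y₁) (x₂ - x₁)
          {{≢-nonZero λ eq → x₁≢x₂ (sym (p-q≡0⇒p≡q x₂ x₁ eq))}}) on₁ on₂)
    where s = chordSlope x₁ y₁ x₂ y₂ x₁≢x₂
  ... | yes _     | yes _ = 𝒪
  ... | yes x₁≡x₂ | no y₁≢-y₂ =
    affine (thirdX s x₁ x₁) (thirdY s x₁ y₁ (thirdX s x₁ x₁))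
      (tangent-onCurve x₁ y₁ s
        (p÷q*q≡p (x₁ * x₁ + x₁ * x₁ + x₁ * x₁ - A²) (y₁ + y₁)
          {{≢-nonZero (2y≢0 x₁ y₁ x₂ y₂ on₁ on₂ x₁≡x₂ y₁≢-y₂)}}) on₁)
    where s = tangentSlope x₁ y₁ (2y≢0 x₁ y₁ x₂ y₂ on₁ on₂ x₁≡x₂ y₁≢-y₂)

  rawGroup : RawGroup 0ℓ 0ℓ
  rawGroup = record
    { Carrier = Point
    ; _≈_     = _≡_
    ; _∙_     = _⊕_
    ; ε       = 𝒪
    ; _⁻¹     = ⊖_
    }

{-# OPTIONS --safe #-}

-- Let X = x - e for a root e of x³ - A²x, so that y² = X q(X) with
-- q(X) = X² + bX + c, and put ζ = X / y = y / q(X) (ζ = 0 at 𝒪). Together with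
-- δ = (X² - c) / q(X) this turns the curve into the Jacobi quartic
-- δ² = 1 - 2bζ² + dζ⁴, d = b² - 4c, where
-- ζ(P + Q) = (ζ(P) δ(Q) + ζ(Q) δ(P)) / (1 - d ζ(P)² ζ(Q)²).
-- If y₀ ≠ 0, some root e makes A ζ(P)² even in ℤ₍₂₎; then every δ and every
-- denominator is odd, and ζ(nP) = ρₙ ζ(P) with ρₙ ∈ ℤ₍₂₎ and ρₙ ≡ n mod 2.
-- Hence nP ≠ 𝒪 for odd n. If 2mP = 𝒪, then mP = - mP, so that mP = 𝒪 or
-- mP = (e , 0); in the latter case m is even, and since q(P₁) q(P₂) q(P₁ + P₂) is
-- a square, so is q(mP) = c. But c is - A² or 2A². The argument only uses the
-- cancellation law - P + (P + Q) = Q, not associativity in general.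
module Submission where

open import Defs
open import Algebra.Bundles using (RawGroup)
import Algebra.Definitions.RawMonoid as RawMonoidDefinitions
import Algebra.Properties.Group as GroupProperties
open import Data.Integer.Base as ℤ using (ℤ; -[1+_]) renaming (+_ to pos)
import Data.Integer.Properties as ℤ
open import Data.Integer.Solver renaming (module +-*-Solver to ℤS)
open import Data.Nat.Base as ℕ using (ℕ; zero; suc)
import Data.Nat.Coprimality as Coprimality
open import Data.Nat.Divisibility using (_∣_; divides)
open import Data.Nat.Induction using (<-rec)
import Data.Nat.Properties as ℕ
open import Data.Parity.Base as ℙ using (Parity; 0ℙ; 1ℙ)
import Data.Parity.Properties as ℙ
open import Data.Product.Base using (_×_; _,_; proj₁; proj₂; ∃; ∃₂; ∃-syntax)
open import Data.Rational.Base hiding (pos)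
open import Data.Rational.Literals using (fromℤ)
open import Data.Rational.Properties
open import Data.Rational.Solver using (module +-*-Solver)
import Data.Rational.Unnormalised.Base as ℚᵘ
import Data.Rational.Unnormalised.Properties as ℚᵘ
open import Data.Sum.Base using (_⊎_; inj₁; inj₂)
open import Relation.Binary.Definitions using (Tri; tri<; tri≈; tri>)
open import Relation.Binary.PropositionalEquality
open import Relation.Nullary using (¬_; yes; no; contradiction)
open import Relation.Nullary.Decidable using (recompute)
open ≡-Reasoning
open +-*-Solver using (solve; _:=_; _:+_; _:*_; _:-_; :-_; con)

-- The coefficients scale with A: for e = εA with ε in {0, 1, -1} one has b = 3εA, c = (3ε² - 1)A²
-- and d = (4 - 3ε²)A². Hence bζ² and dζ⁴ are 2-integral multiples of Aζ² and (Aζ²)², and the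
-- evenness of this one number controls the whole addition formula. With u = x₀ / A it equals (u -
-- ε)² / (u³ - u). For ε = 0 this is u / (u² - 1), which is even unless u is a 2-adic unit. For odd
-- u and ε = 1 or -1 it is (u - ε) / (u (u + ε)); exactly one of the even numbers u - 1 and u + 1 is
-- divisible by 4, which dictates the sign. The obstacle is that ζ vanishes at (e , 0) as well as at
-- 𝒪, so that ζ alone cannot tell whether an even multiple is (e , 0). The square class of q settles
-- this. Since X q(X) = y², it is the class of X at points off the axis, that is, the homomorphism
-- of 2-descent; q extends it to (e , 0), where X vanishes but q is c. So c must not be a square: -
-- A² is negative, and 2 is not a rational square.

-- Cancellation in the field of rationals.

p≡q⇒p-q≡0 : ∀ {p q} → p ≡ q → p - q ≡ 0ℚ
p≡q⇒p-q≡0 {p} refl = +-inverseʳ p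

p≢q⇒q-p≢0 : ∀ {p q} → p ≢ q → q - p ≢ 0ℚ
p≢q⇒q-p≢0 p≢q q-p≡0 = p≢q (sym (p-q≡0⇒p≡q _ _ q-p≡0))

÷-unique : ∀ {p q r} .{{_ : NonZero q}} → r * q ≡ p → p ÷ q ≡ r
÷-unique {p} {q} {r} rq≡p = begin
  p * 1/ q        ≡⟨ cong (_* 1/ q) rq≡p ⟨
  r * q * 1/ q    ≡⟨ *-assoc r q (1/ q) ⟩
  r * (q * 1/ q)  ≡⟨ cong (r *_) (*-inverseʳ q) ⟩
  r * 1ℚ          ≡⟨ *-identityʳ r ⟩
  r               ∎

p*p≡0⇒p≡0 : ∀ p → p * p ≡ 0ℚ → p ≡ 0ℚ
p*p≡0⇒p≡0 p pp≡0 with p ≟ 0ℚ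
... | yes p≡0 = p≡0
... | no  p≢0 = p*q≡0∧p≢0⇒q≡0 p p p≢0 pp≡0

p*q≢0 : ∀ {p q} → p ≢ 0ℚ → q ≢ 0ℚ → p * q ≢ 0ℚ
p*q≢0 {p} {q} p≢0 q≢0 pq≡0 = q≢0 (p*q≡0∧p≢0⇒q≡0 p q p≢0 pq≡0)

-p≡p⇒p≡0 : ∀ p → p ≡ - p → p ≡ 0ℚ
-p≡p⇒p≡0 p p≡-p = p*q≡0∧p≢0⇒q≡0 (1ℚ + 1ℚ) p (λ ()) (begin
  (1ℚ + 1ℚ) * p ≡⟨ solve 1 (λ p → (con 1ℚ :+ con 1ℚ) :* p := p :- (:- p)) refl p ⟩
  p - - p       ≡⟨ p≡q⇒p-q≡0 p≡-p ⟩
  0ℚ            ∎)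

*-cancelˡ-≢0 : ∀ {p q r} → p ≢ 0ℚ → p * q ≡ p * r → q ≡ r
*-cancelˡ-≢0 {p} {q} {r} p≢0 pq≡pr = p-q≡0⇒p≡q q r (p*q≡0∧p≢0⇒q≡0 p (q - r) p≢0
  (trans (solve 3 (λ p q r → p :* (q :- r) := p :* q :- p :* r) refl p q r) (p≡q⇒p-q≡0 pq≡pr)))

p≡r*s∧s≡0⇒p≡0 : ∀ {p r s} → p ≡ r * s → s ≡ 0ℚ → p ≡ 0ℚ
p≡r*s∧s≡0⇒p≡0 {r = r} p≡rs s≡0 = trans p≡rs (trans (cong (r *_) s≡0) (*-zeroʳ r))

square-injective : ∀ {p q} → p * p ≡ q * q → p ≢ - q → p ≡ q
square-injective {p} {q} pp≡qq p≢-q = p-q≡0⇒p≡q p q (p*q≡0∧p≢0⇒q≡0 (p + q) (p - q)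
  (λ p+q≡0 → p≢-q (p-q≡0⇒p≡q p (- q) (trans (solve 2 (λ p q → p :- (:- q) :=
       p :+ q) refl p q) p+q≡0)))
  (trans (solve 2 (λ p q → (p :+ q) :* (p :- q) := p :* p :- q :* q) refl p q) (p≡q⇒p-q≡0 pp≡qq)))

-‿involutive : ∀ p → - - p ≡ p
-‿involutive = GroupProperties.⁻¹-involutive +-0-group

-- Parity in ℤ₍₂₎

fromℤ-homo-+ : ∀ i j → fromℤ (i ℤ.+ j) ≡ fromℤ i + fromℤ j
fromℤ-homo-+ i j = toℚᵘ-injective (ℚᵘ.≃-trans
  (ℚᵘ.*≡* (cong₂ (λ k l → (k ℤ.+ l) ℤ.* pos 1) (sym (ℤ.*-identityʳ i)) (sym (ℤ.*-identityʳ j))))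
  (ℚᵘ.≃-sym (toℚᵘ-homo-+ (fromℤ i) (fromℤ j))))

fromℤ-homo-* : ∀ i j → fromℤ (i ℤ.* j) ≡ fromℤ i * fromℤ j
fromℤ-homo-* i j = toℚᵘ-injective (ℚᵘ.≃-sym (toℚᵘ-homo-* (fromℤ i) (fromℤ j)))

fromℤ-injective : ∀ {i j} → fromℤ i ≡ fromℤ j → i ≡ j
fromℤ-injective eq = cong ↥_ eq

*-denominator : ∀ q → q * fromℤ (↧ q) ≡ fromℤ (↥ q)
*-denominator q@record{} = toℚᵘ-injective (ℚᵘ.≃-trans (toℚᵘ-homo-* q (fromℤ (↧ q)))
  (ℚᵘ.*≡* (trans (ℤ.*-identityʳ _) (cong (↥ q ℤ.*_) (cong pos (sym (ℕ.*-identityʳ (↧ₙ q))))))))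

-- With the parity as an index, one closure lemma per operation covers all cases, and the parity of
-- a compound expression is computed in the ring `Parity`.
data IntegerParity : Parity → ℤ → Set where
  even : ∀ m → IntegerParity 0ℙ (m ℤ.+ m)
  odd  : ∀ m → IntegerParity 1ℙ (ℤ.1ℤ ℤ.+ (m ℤ.+ m))

parity-+ : ∀ {π σ i j} → IntegerParity π i → IntegerParity σ j →
           IntegerParity (π ℙ.+ σ) (i ℤ.+ j)
parity-+ (even m) (even n) = subst (IntegerParity 0ℙ)
  (ℤS.solve 2 (λ m n → (m ℤS.:+ n) ℤS.:+ (m ℤS.:+ n) ℤS.:=
       (m ℤS.:+ m) ℤS.:+ (n ℤS.:+ n)) refl m n)
  (even (m ℤ.+ n))
parity-+ (even m) (odd n) = subst (IntegerParity 1ℙ)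
  (ℤS.solve 2 (λ m n → ℤS.con ℤ.1ℤ ℤS.:+ ((m ℤS.:+ n) ℤS.:+ (m ℤS.:+ n)) ℤS.:=
       (m ℤS.:+ m) ℤS.:+ (ℤS.con ℤ.1ℤ ℤS.:+ (n ℤS.:+ n))) refl m n)
  (odd (m ℤ.+ n))
parity-+ (odd m) (even n) = subst (IntegerParity 1ℙ)
  (ℤS.solve 2 (λ m n → ℤS.con ℤ.1ℤ ℤS.:+ ((m ℤS.:+ n) ℤS.:+ (m ℤS.:+ n)) ℤS.:=
       (ℤS.con ℤ.1ℤ ℤS.:+ (m ℤS.:+ m)) ℤS.:+ (n ℤS.:+ n)) refl m n)
  (odd (m ℤ.+ n))
parity-+ (odd m) (odd n) = subst (IntegerParity 0ℙ)
  (ℤS.solve 2 (λ m n → let k = ℤS.con ℤ.1ℤ ℤS.:+ (m ℤS.:+ n) in k ℤS.:+ k ℤS.:=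
       (ℤS.con ℤ.1ℤ ℤS.:+ (m ℤS.:+ m)) ℤS.:+ (ℤS.con ℤ.1ℤ ℤS.:+ (n ℤS.:+ n))) refl m n)
  (even (ℤ.1ℤ ℤ.+ (m ℤ.+ n)))

parity-* : ∀ {π σ i j} → IntegerParity π i → IntegerParity σ j →
           IntegerParity (π ℙ.* σ) (i ℤ.* j)
parity-* {j = j} (even m) _ = subst (IntegerParity 0ℙ)
  (sym (ℤ.*-distribʳ-+ j m m)) (even (m ℤ.* j))
parity-* {σ = σ} {j = j} (odd m) p = subst₂ IntegerParity (ℙ.+-identityʳ σ)
  (ℤS.solve 2 (λ m j → j ℤS.:+ (m ℤS.:* j ℤS.:+ m ℤS.:* j) ℤS.:=
       (ℤS.con ℤ.1ℤ ℤS.:+ (m ℤS.:+ m)) ℤS.:* j) refl m j)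
  (parity-+ p (even (m ℤ.* j)))

-- Two representations of one integer would give 2 (m - n) = 1, which absolute values carry over to
-- ℕ. `go` takes the equation as an argument because `m + m` cannot be unified with the index of
-- `odd`.
parity-unique : ∀ {i} → IntegerParity 0ℙ i → ¬ IntegerParity 1ℙ i
parity-unique (even m) p = go m p refl
  where
  2*k≢1 : ∀ k → k ℕ.+ k ≢ 1
  2*k≢1 (suc zero) ()
  2*k≢1 (suc (suc k)) ()
  go : ∀ {i} m → IntegerParity 1ℙ i → i ≢ m ℤ.+ m
  go m (odd n) eq = 2*k≢1 ℤ.∣ m ℤ.- n ∣ (begin
    ℤ.∣ m ℤ.- n ∣ ℕ.+ ℤ.∣ m ℤ.- n ∣ ≡⟨ cong (ℤ.∣ m ℤ.- n ∣ ℕ.+_) (ℕ.+-identityʳ _) ⟨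
    2 ℕ.* ℤ.∣ m ℤ.- n ∣ ≡⟨ ℤ.abs-* (pos 2) (m ℤ.- n) ⟨
    ℤ.∣ pos 2 ℤ.* (m ℤ.- n) ∣
      ≡⟨ cong ℤ.∣_∣ (ℤS.solve 2 (λ m n → ℤS.con (pos 2) ℤS.:* (m ℤS.:- n) ℤS.:=
           (m ℤS.:+ m) ℤS.:- (n ℤS.:+ n)) refl m n) ⟩
    ℤ.∣ (m ℤ.+ m) ℤ.- (n ℤ.+ n) ∣ ≡⟨ cong (λ z → ℤ.∣ z ℤ.- (n ℤ.+ n) ∣) eq ⟨
    ℤ.∣ (ℤ.1ℤ ℤ.+ (n ℤ.+ n)) ℤ.- (n ℤ.+ n) ∣
      ≡⟨ cong ℤ.∣_∣ (ℤS.solve 1 (λ n → (ℤS.con ℤ.1ℤ ℤS.:+ (n ℤS.:+ n)) ℤS.:- (n ℤS.:+ n) ℤS.:=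
           ℤS.con ℤ.1ℤ) refl n) ⟩
    1 ∎)

parityℕ : ∀ n → ∃[ π ] IntegerParity π (pos n)
parityℕ zero = 0ℙ , even (pos 0)
parityℕ (suc n) with parityℕ n
... | π , p = 1ℙ ℙ.+ π , parity-+ (odd (pos 0)) p

parityℤ : ∀ i → ∃[ π ] IntegerParity π i
parityℤ (pos n) = parityℕ n
parityℤ -[1+ n ] with parityℕ (suc n)
... | π , p = π , subst (IntegerParity π) (ℤ.-1*i≡-i (pos (suc n))) (parity-* (odd ℤ.-1ℤ) p)

-- Membership in ℤ₍₂₎ together with the residue modulo 2. The fraction need not be in lowest terms,
-- so sums, products and quotients require no normalisation.
record HasParity (π : Parity) (q : ℚ) : Set where
  constructor fraction
  field
    num den    : ℤ
    num-parity : IntegerParity π num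
    den-odd    : IntegerParity 1ℙ den
    q*den≡num  : q * fromℤ den ≡ fromℤ num

hasParity-+ : ∀ {π σ p q} → HasParity π p → HasParity σ q → HasParity (π ℙ.+ σ) (p + q)
hasParity-+ {π} {σ} {p} {q} (fraction i j i-π j-odd pj≡i) (fraction k l k-σ l-odd ql≡k) =
  fraction (i ℤ.* l ℤ.+ k ℤ.* j) (j ℤ.* l)
  (subst₂ (λ π′ σ′ → IntegerParity (π′ ℙ.+ σ′) _) (ℙ.*-identityʳ π) (ℙ.*-identityʳ σ)
    (parity-+ (parity-* i-π l-odd) (parity-* k-σ j-odd)))
  (parity-* j-odd l-odd) (begin
  (p + q) * fromℤ (j ℤ.* l) ≡⟨ cong ((p + q) *_) (fromℤ-homo-* j l) ⟩
  (p + q) * (fromℤ j * fromℤ l)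
    ≡⟨ solve 4 (λ p q j l → (p :+ q) :* (j :* l) :=
         p :* j :* l :+ q :* l :* j) refl p q (fromℤ j) (fromℤ l) ⟩
  p * fromℤ j * fromℤ l + q * fromℤ l * fromℤ j
    ≡⟨ cong₂ (λ u v → u * fromℤ l + v * fromℤ j) pj≡i ql≡k ⟩
  fromℤ i * fromℤ l + fromℤ k * fromℤ j ≡⟨ cong₂ _+_ (fromℤ-homo-* i l) (fromℤ-homo-* k j) ⟨
  fromℤ (i ℤ.* l) + fromℤ (k ℤ.* j) ≡⟨ fromℤ-homo-+ (i ℤ.* l) (k ℤ.* j) ⟨
  fromℤ (i ℤ.* l ℤ.+ k ℤ.* j) ∎)

hasParity-* : ∀ {π σ p q} → HasParity π p → HasParity σ q → HasParity (π ℙ.* σ) (p * q)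
hasParity-* {p = p} {q} (fraction i j i-π j-odd pj≡i) (fraction k l k-σ l-odd ql≡k) =
  fraction (i ℤ.* k) (j ℤ.* l) (parity-* i-π k-σ) (parity-* j-odd l-odd) (begin
  p * q * fromℤ (j ℤ.* l) ≡⟨ cong (p * q *_) (fromℤ-homo-* j l) ⟩
  p * q * (fromℤ j * fromℤ l)
    ≡⟨ solve 4 (λ p q j l → p :* q :* (j :* l) :=
         p :* j :* (q :* l)) refl p q (fromℤ j) (fromℤ l) ⟩
  p * fromℤ j * (q * fromℤ l) ≡⟨ cong₂ _*_ pj≡i ql≡k ⟩
  fromℤ i * fromℤ k ≡⟨ fromℤ-homo-* i k ⟨
  fromℤ (i ℤ.* k) ∎)

hasParity-unique : ∀ {q} → HasParity 0ℙ q → ¬ HasParity 1ℙ q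
hasParity-unique {q} (fraction i j i-even j-odd qj≡i) (fraction k l k-odd l-odd ql≡k) =
  parity-unique (parity-* i-even l-odd)
    (subst (IntegerParity 1ℙ) (fromℤ-injective (begin
      fromℤ (k ℤ.* j) ≡⟨ fromℤ-homo-* k j ⟩
      fromℤ k * fromℤ j ≡⟨ cong (_* fromℤ j) ql≡k ⟨
      q * fromℤ l * fromℤ j
        ≡⟨ solve 3 (λ q l j → q :* l :* j := q :* j :* l) refl q (fromℤ l) (fromℤ j) ⟩
      q * fromℤ j * fromℤ l ≡⟨ cong (_* fromℤ l) qj≡i ⟩
      fromℤ i * fromℤ l ≡⟨ fromℤ-homo-* i l ⟨
      fromℤ (i ℤ.* l) ∎)) (parity-* k-odd j-odd))

hasParity-fromℤ : ∀ {π i} → IntegerParity π i → HasParity π (fromℤ i)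
hasParity-fromℤ {i = i} p = fraction i ℤ.1ℤ p (odd (pos 0)) (*-identityʳ (fromℤ i))

hasParity-0 : HasParity 0ℙ 0ℚ
hasParity-0 = hasParity-fromℤ (even (pos 0))

hasParity-1 : HasParity 1ℙ 1ℚ
hasParity-1 = hasParity-fromℤ (odd (pos 0))

hasParity-neg : ∀ {π q} → HasParity π q → HasParity π (- q)
hasParity-neg {π} {q} p = subst (HasParity π)
  (solve 1 (λ q → con (fromℤ -[1+ 0 ]) :* q := :- q) refl q)
  (hasParity-* (hasParity-fromℤ (odd -[1+ 0 ])) p)

hasParity-- : ∀ {π σ p q} → HasParity π p → HasParity σ q → HasParity (π ℙ.+ σ) (p - q)
hasParity-- p q = hasParity-+ p (hasParity-neg q)

hasParity-double : ∀ {π q} → HasParity π q → HasParity 0ℙ (q + q)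
hasParity-double {π} p = subst (λ σ → HasParity σ _) (ℙ.p+p≡0ℙ π) (hasParity-+ p p)

odd≢0 : ∀ {q} → HasParity 1ℙ q → q ≢ 0ℚ
odd≢0 p refl = hasParity-unique hasParity-0 p

-- Odd elements are the units of ℤ₍₂₎, and they are 1 modulo 2. The quotient is given by its
-- equation, so that the lemma also serves numbers that are not literally written as this division.
hasParity-÷odd : ∀ {π p q r} → HasParity π p → HasParity 1ℙ q → r * q ≡ p → HasParity π r
hasParity-÷odd {π} {p} {q} {r} (fraction i j i-π j-odd pj≡i) (fraction k l k-odd l-odd ql≡k) rq≡p =
  fraction (i ℤ.* l) (k ℤ.* j)
  (subst (λ σ → IntegerParity σ (i ℤ.* l)) (ℙ.*-identityʳ π) (parity-* i-π l-odd))
  (parity-* k-odd j-odd) (begin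
  r * fromℤ (k ℤ.* j) ≡⟨ cong (r *_) (fromℤ-homo-* k j) ⟩
  r * (fromℤ k * fromℤ j) ≡⟨ cong (λ z → r * (z * fromℤ j)) ql≡k ⟨
  r * (q * fromℤ l * fromℤ j)
    ≡⟨ solve 4 (λ r q l j → r :* (q :* l :* j) := r :* q :* j :* l) refl r q (fromℤ l) (fromℤ j) ⟩
  r * q * fromℤ j * fromℤ l ≡⟨ cong (λ z → z * fromℤ j * fromℤ l) rq≡p ⟩
  p * fromℤ j * fromℤ l ≡⟨ cong (_* fromℤ l) pj≡i ⟩
  fromℤ i * fromℤ l ≡⟨ fromℤ-homo-* i l ⟨
  fromℤ (i ℤ.* l) ∎)

even⇒2∣ : ∀ {i} → IntegerParity 0ℙ i → 2 ∣ ℤ.∣ i ∣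
even⇒2∣ (even m) = divides ℤ.∣ m ∣ (begin
  ℤ.∣ m ℤ.+ m ∣ ≡⟨ cong ℤ.∣_∣ (ℤS.solve 1 (λ m → m ℤS.:+ m ℤS.:= m ℤS.:* ℤS.con (pos 2)) refl m) ⟩
  ℤ.∣ m ℤ.* pos 2 ∣ ≡⟨ ℤ.abs-* m (pos 2) ⟩
  ℤ.∣ m ∣ ℕ.* 2 ∎)

-- ℤ₍₂₎ is a valuation ring: in lowest terms an even denominator forces an odd numerator, and then
-- the inverse fraction is even.
integral⊎inverse-even : ∀ q → (∃[ π ] HasParity π q) ⊎ (∃[ r ] q * r ≡ 1ℚ × HasParity 0ℙ r)
integral⊎inverse-even q@(mkℚ num d-1 coprime)
  with parityℤ (↧ q) | parityℤ num
... | 1ℙ , den-odd | π , num-π = inj₁ (π , fraction num (↧ q) num-π den-odd (*-denominator q))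
... | 0ℙ , den-even | 0ℙ , num-even =
  contradiction (Coprimality.recompute coprime (even⇒2∣ num-even , even⇒2∣ den-even)) λ ()
... | 0ℙ , den-even | 1ℙ , num-odd = inj₂ (1/ q , *-inverseʳ q , fraction (↧ q) num den-even num-odd (begin
  1/ q * fromℤ num ≡⟨ cong (1/ q *_) (*-denominator q) ⟨
  1/ q * (q * fromℤ (↧ q)) ≡⟨ *-assoc (1/ q) q _ ⟨
  1/ q * q * fromℤ (↧ q) ≡⟨ cong (_* fromℤ (↧ q)) (*-inverseˡ q) ⟩
  1ℚ * fromℤ (↧ q) ≡⟨ *-identityˡ _ ⟩
  fromℤ (↧ q) ∎))
  where
  instance _ = ≢-nonZero {q} λ q≡0 →
                 parity-unique (even (pos 0)) (subst (IntegerParity 1ℙ) (p≡0⇒↥p≡0 q q≡0) num-odd)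

-- ℤ₍₂₎ is integrally closed: if q had an even inverse r, then 1 = r²q² would be even. Needed
-- because δ is controlled only through δ².
square-odd⇒odd : ∀ {q} → HasParity 1ℙ (q * q) → HasParity 1ℙ q
square-odd⇒odd {q} qq-odd with integral⊎inverse-even q
... | inj₁ (1ℙ , q-odd)  = q-odd
... | inj₁ (0ℙ , q-even) = contradiction qq-odd (hasParity-unique (hasParity-* q-even q-even))
... | inj₂ (r , qr≡1 , r-even) = contradiction hasParity-1 (hasParity-unique (subst (HasParity 0ℙ)
  (begin
    r * r * (q * q)   ≡⟨ solve 2 (λ q r → r :* r :* (q :* q) := q :* r :* (q :* r)) refl q r ⟩
    q * r * (q * r)   ≡⟨ cong₂ _*_ qr≡1 qr≡1 ⟩
    1ℚ                ∎) (hasParity-* (hasParity-* r-even r-even) qq-odd)))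

half : ∀ {q} → HasParity 0ℙ q → ∃₂ λ π h → HasParity π h × q ≡ h + h
half {q} (fraction _ j (even m) j-odd qj≡2m) with parityℤ m
... | π , m-π = π , ½ * q , fraction m j m-π j-odd (begin
  ½ * q * fromℤ j              ≡⟨ *-assoc ½ q (fromℤ j) ⟩
  ½ * (q * fromℤ j)            ≡⟨ cong (½ *_) (trans qj≡2m (fromℤ-homo-+ m m)) ⟩
  ½ * (fromℤ m + fromℤ m)      ≡⟨ solve 1 (λ m → con ½ :* (m :+ m) := m) refl (fromℤ m) ⟩
  fromℤ m                      ∎) , solve 1 (λ q → q := con ½ :* q :+ con ½ :* q) refl q

-- The three cases are the sign of the 2-adic valuation: an odd q has an odd square, q = 2h gives
-- 2h² = 1, and an even inverse r gives 1 = 2r².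
2≢square : ∀ q → q * q ≢ 1ℚ + 1ℚ
2≢square q qq≡2 with integral⊎inverse-even q
... | inj₁ (1ℙ , q-odd) = hasParity-unique
  (subst (HasParity 0ℙ) (sym qq≡2) (hasParity-double hasParity-1)) (hasParity-* q-odd q-odd)
... | inj₁ (0ℙ , q-even) with half q-even
...   | π , h , h-π , refl = hasParity-unique
  (hasParity-double (hasParity-* h-π h-π)) (subst (HasParity 1ℙ) (sym (*-cancelˡ-≢0 {1ℚ + 1ℚ} (λ ()) (begin
    (1ℚ + 1ℚ) * (h * h + h * h)
      ≡⟨ solve 1 (λ h → (con 1ℚ :+ con 1ℚ) :* (h :* h :+ h :* h) := (h :+ h) :* (h :+ h)) refl h ⟩
    (h + h) * (h + h)            ≡⟨ qq≡2 ⟩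
    (1ℚ + 1ℚ) * 1ℚ               ∎))) hasParity-1)
2≢square q qq≡2 | inj₂ (r , qr≡1 , r-even) = hasParity-unique
  (hasParity-double (hasParity-* r-even r-even)) (subst (HasParity 1ℙ) (begin
    1ℚ                  ≡⟨ cong₂ _*_ qr≡1 qr≡1 ⟨
    q * r * (q * r)     ≡⟨ solve 2 (λ q r → q :* r :* (q :* r) := q :* q :* (r :* r)) refl q r ⟩
    q * q * (r * r)     ≡⟨ cong (_* (r * r)) qq≡2 ⟩
    (1ℚ + 1ℚ) * (r * r) ≡⟨ solve 1 (λ r → (con 1ℚ :+ con 1ℚ) :* r := r :+ r) refl (r * r) ⟩
    r * r + r * r       ∎) hasParity-1)

-- Positivity of squares.

square-nonNeg : ∀ p → NonNegative (p * p)
square-nonNeg p@(mkℚ (pos _) _ _)    = nonNeg*nonNeg⇒nonNeg p p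
square-nonNeg p@(mkℚ -[1+ _ ] _ _) = pos⇒nonNeg (p * p) {{neg*neg⇒pos p p}}

square-pos : ∀ {p} → p ≢ 0ℚ → Positive (p * p)
square-pos {p} p≢0 = nonNeg∧nonZero⇒pos (p * p) {{square-nonNeg p}} {{≢-nonZero (p*q≢0 p≢0 p≢0)}}

sum-of-squares≢0 : ∀ p {q} → q ≢ 0ℚ → p * p + q * q ≢ 0ℚ
sum-of-squares≢0 p {q} q≢0 eq = <-irrefl (sym eq)
  (positive⁻¹ _ {{nonNeg+pos⇒pos (p * p) {{square-nonNeg p}} (q * q) {{square-pos q≢0}}}})

-- The group law

module GroupLaw (A : ℕ) (A²≢0 : fromℕ A * fromℕ A ≢ 0ℚ) where
  open CongruentNumberCurve A
  open RawMonoidDefinitions (RawGroup.rawMonoid rawGroup) using () renaming (_×_ to infixr 8 _·_) public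

  -- The line Y = sX + ν meets the curve in P₁, P₂ and - P₃: the three abscissae
  -- are the roots of X³ - A²X - (sX + ν)², whose coefficients are compared.
  record IsSum (x₁ y₁ x₂ y₂ x₃ y₃ : ℚ) : Set where
    constructor line
    field
      s ν : ℚ
      P₁∈ : s * x₁ + ν ≡ y₁
      P₂∈ : s * x₂ + ν ≡ y₂
      P₃∈ : s * x₃ + ν ≡ - y₃
      e₁  : x₁ + x₂ + x₃ ≡ s * s
      e₂  : x₁ * x₂ + x₁ * x₃ + x₂ * x₃ + A² + (s * ν + s * ν) ≡ 0ℚ
      e₃  : x₁ * x₂ * x₃ ≡ ν * ν

  isSum-⊖ : ∀ {x₁ y₁ x₂ y₂ x₃ y₃} → IsSum x₁ y₁ x₂ y₂ x₃ y₃ →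
            IsSum x₁ (- y₁) x₂ (- y₂) x₃ (- y₃)
  isSum-⊖ {x₁} {y₁} {x₂} {y₂} {x₃} {y₃} (line s ν P₁∈ P₂∈ P₃∈ e₁ e₂ e₃) =
    line (- s) (- ν) (negate P₁∈) (negate P₂∈) (negate P₃∈)
    (trans e₁ (solve 1 (λ s → s :* s := (:- s) :* (:- s)) refl s))
    (trans (cong (x₁ * x₂ + x₁ * x₃ + x₂ * x₃ + A² +_)
      (solve 2 (λ s ν → (:- s) :* (:- ν) :+ (:- s) :* (:- ν) := s :* ν :+ s :* ν) refl s ν)) e₂)
    (trans e₃ (solve 1 (λ s → s :* s := (:- s) :* (:- s)) refl ν))
    where
    negate : ∀ {x y} → s * x + ν ≡ y → - s * x + - ν ≡ - y
    negate {x} eq = trans (solve 3 (λ s x ν → (:- s) :* x :+ (:- ν) :=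
         :- (s :* x :+ ν)) refl s x ν) (cong -_ eq)

  -- The reflected line passes through ⊖ P₁, ⊖ P₂ and P₃, and collinearity with multiplicities is
  -- symmetric in the three points. This is what the comparison of coefficients in `IsSum` is made
  -- for: tangents need no separate treatment.
  isSum-cancel : ∀ {x₁ y₁ x₂ y₂ x₃ y₃} → IsSum x₁ y₁ x₂ y₂ x₃ y₃ →
                 IsSum x₁ (- y₁) x₃ y₃ x₂ y₂
  isSum-cancel {x₁} {y₁} {x₂} {y₂} {x₃} {y₃} P₁+P₂≡P₃ = line s ν P₁∈
    (trans P₃∈ (solve 1 (λ y → :- (:- y) := y) refl y₃)) P₂∈
    (trans (solve 3 (λ x₁ x₂ x₃ → x₁ :+ x₃ :+ x₂ := x₁ :+ x₂ :+ x₃) refl x₁ x₂ x₃) e₁)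
    (trans (cong (λ z → z + A² + (s * ν + s * ν))
      (solve 3 (λ x₁ x₂ x₃ → x₁ :* x₃ :+ x₁ :* x₂ :+ x₃ :* x₂ :=
           x₁ :* x₂ :+ x₁ :* x₃ :+ x₂ :* x₃) refl x₁ x₂ x₃)) e₂)
    (trans (solve 3 (λ x₁ x₂ x₃ → x₁ :* x₃ :* x₂ := x₁ :* x₂ :* x₃) refl x₁ x₂ x₃) e₃)
    where open IsSum (isSum-⊖ P₁+P₂≡P₃)

  recompute-onCurve : ∀ x y → .(OnCurve x y) → OnCurve x y
  recompute-onCurve x y on = recompute (_ ≟ _) on

  affine-cong : ∀ {x y x′ y′} .(on : OnCurve x y) .(on′ : OnCurve x′ y′) →
                x ≡ x′ → y ≡ y′ → affine x y on ≡ affine x′ y′ on′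
  affine-cong on on′ refl refl = refl

  -- The abscissa x is a double root of X³ - A²X - (sX + ν)², so the derivative vanishes there.
  tangent-slope : ∀ {x y₁ y₂ x₃ y₃} (P : IsSum x y₁ x y₂ x₃ y₃) → let open IsSum P in
                  s * (y₁ + y₁) ≡ x * x + x * x + x * x - A²
  tangent-slope {x} {y₁} {x₃ = x₃} (line s ν P₁∈ P₂∈ P₃∈ e₁ e₂ e₃) = begin
    s * (y₁ + y₁) ≡⟨ cong (λ y → s * (y + y)) P₁∈ ⟨
    s * ((s * x + ν) + (s * x + ν))
      ≡⟨ solve 5 (λ s x ν x₃ a →
           s :* ((s :* x :+ ν) :+ (s :* x :+ ν)) :=
           x :* x :+ x :* x :+ x :* x :- a
           :+ (x :* x :+ x :* x₃ :+ x :* x₃ :+ a :+ (s :* ν :+ s :* ν))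
           :- (x :+ x) :* (x :+ x :+ x₃ :- s :* s)) refl s x ν x₃ A² ⟩
    x * x + x * x + x * x - A² + (x * x + x * x₃ + x * x₃ + A² + (s * ν + s * ν))
    - (x + x) * (x + x + x₃ - s * s)
      ≡⟨ cong₂ (λ u v → x * x + x * x + x * x - A² + u - (x + x) * v) e₂ (p≡q⇒p-q≡0 e₁) ⟩
    x * x + x * x + x * x - A² + 0ℚ - (x + x) * 0ℚ
      ≡⟨ solve 2 (λ x a → x :* x :+ x :* x :+ x :* x :- a :+ con 0ℚ :- (x :+ x) :* con 0ℚ
           := x :* x :+ x :* x :+ x :* x :- a) refl x A² ⟩
    x * x + x * x + x * x - A² ∎

  -- Smoothness: 2x⁴ lies in the ideal generated by 3x² - A² and x³ - A²x, so a singular point has x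
  -- = 0 and therefore A² = 0.
  no-singular-point : ∀ x y → OnCurve x y → y ≡ 0ℚ → x * x + x * x + x * x - A² ≢ 0ℚ
  no-singular-point x _ on refl 3x²-A²≡0 = A²≢0 (begin
    A² ≡⟨ p-q≡0⇒p≡q _ _ 3x²-A²≡0 ⟨
    x * x + x * x + x * x ≡⟨ cong (λ x → x * x + x * x + x * x) x≡0 ⟩
    0ℚ ∎)
    where
    x≡0 : x ≡ 0ℚ
    x≡0 = p*p≡0⇒p≡0 x (p*p≡0⇒p≡0 (x * x) (p*q≡0∧p≢0⇒q≡0 (1ℚ + 1ℚ) _ (λ ()) (begin
      (1ℚ + 1ℚ) * (x * x * (x * x))
        ≡⟨ solve 2 (λ x a → (con 1ℚ :+ con 1ℚ) :* (x :* x :* (x :* x)) :=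
             x :* x :* (x :* x :+ x :* x :+ x :* x :- a) :- x :* (x :* x :* x :- a :* x)) refl x A² ⟩
      x * x * (x * x + x * x + x * x - A²) - x * (x * x * x - A² * x)
        ≡⟨ cong₂ (λ u v → x * x * u - x * v) 3x²-A²≡0 (sym on) ⟩
      x * x * 0ℚ - x * 0ℚ
        ≡⟨ solve 1 (λ x → x :* x :* con 0ℚ :- x :* con 0ℚ := con 0ℚ) refl x ⟩
      0ℚ ∎)))

  third : ∀ {x₁ y₁ x₂ y₂ x₃ y₃} (P : IsSum x₁ y₁ x₂ y₂ x₃ y₃) → let open IsSum P in
          thirdX s x₁ x₂ ≡ x₃ × thirdY s x₁ y₁ (thirdX s x₁ x₂) ≡ y₃
  third {x₁} {y₁} {x₂} {y₂} {x₃} {y₃} (line s ν P₁∈ P₂∈ P₃∈ e₁ e₂ e₃) = X≡x₃ , (begin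
    s * (x₁ - thirdX s x₁ x₂) - y₁  ≡⟨ cong₂ (λ x y → s * (x₁ - x) - y) X≡x₃ (sym P₁∈) ⟩
    s * (x₁ - x₃) - (s * x₁ + ν)
      ≡⟨ solve 4 (λ s x₁ x₃ ν → s :* (x₁ :- x₃) :- (s :* x₁ :+ ν) :=
           :- (s :* x₃ :+ ν)) refl s x₁ x₃ ν ⟩
    - (s * x₃ + ν)                  ≡⟨ cong -_ P₃∈ ⟩
    - - y₃                          ≡⟨ solve 1 (λ y → :- (:- y) := y) refl y₃ ⟩
    y₃                              ∎)
    where
    X≡x₃ : thirdX s x₁ x₂ ≡ x₃
    X≡x₃ = begin
      s * s - x₁ - x₂           ≡⟨ cong (λ z → z - x₁ - x₂) e₁ ⟨
      x₁ + x₂ + x₃ - x₁ - x₂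
        ≡⟨ solve 3 (λ x₁ x₂ x₃ → x₁ :+ x₂ :+ x₃ :- x₁ :- x₂ := x₃) refl x₁ x₂ x₃ ⟩
      x₃                        ∎

  chordSlope-unique : ∀ {x₁ y₁ x₂ y₂ x₃ y₃} (x₁≢x₂ : x₁ ≢ x₂) (P : IsSum x₁ y₁ x₂ y₂ x₃ y₃) →
                      chordSlope x₁ y₁ x₂ y₂ x₁≢x₂ ≡ IsSum.s P
  chordSlope-unique {x₁} {y₁} {x₂} {y₂} x₁≢x₂ (line s ν P₁∈ P₂∈ P₃∈ e₁ e₂ e₃) =
    ÷-unique {{≢-nonZero (p≢q⇒q-p≢0 x₁≢x₂)}} (begin
      s * (x₂ - x₁)
        ≡⟨ solve 4 (λ s x₁ x₂ ν → s :* (x₂ :- x₁) :=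
             (s :* x₂ :+ ν) :- (s :* x₁ :+ ν)) refl s x₁ x₂ ν ⟩
      (s * x₂ + ν) - (s * x₁ + ν)   ≡⟨ cong₂ _-_ P₂∈ P₁∈ ⟩
      y₂ - y₁                       ∎)

  tangentSlope-unique : ∀ {x y₁ y₂ x₃ y₃} .(2y₁≢0 : y₁ + y₁ ≢ 0ℚ) (P : IsSum x y₁ x y₂ x₃ y₃) →
                        tangentSlope x y₁ 2y₁≢0 ≡ IsSum.s P
  tangentSlope-unique 2y₁≢0 P = ÷-unique {{≢-nonZero 2y₁≢0}} (tangent-slope P)

  affine-third : ∀ {x₁ y₁ x₂ y₂ x₃ y₃ s} (P : IsSum x₁ y₁ x₂ y₂ x₃ y₃) → s ≡ IsSum.s P →
                 .(on : OnCurve (thirdX s x₁ x₂) (thirdY s x₁ y₁ (thirdX s x₁ x₂))) .(on₃ : OnCurve x₃ y₃) →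
                 affine (thirdX s x₁ x₂) (thirdY s x₁ y₁ (thirdX s x₁ x₂)) on ≡ affine x₃ y₃ on₃
  affine-third P refl on on₃ = affine-cong on on₃ (proj₁ (third P)) (proj₂ (third P))

  -- On a line of finite slope equal abscissae give equal ordinates. Opposite ordinates would then
  -- both be 0, and the tangency condition would make the point singular.
  no-vertical-line : ∀ {x y₁ y₂ x₃ y₃} → OnCurve x y₁ → IsSum x y₁ x y₂ x₃ y₃ → y₁ ≢ - y₂
  no-vertical-line {x} {y₁} on P y₁≡-y₂ = no-singular-point x y₁ on y₁≡0
    (trans (sym (tangent-slope P)) (trans (cong (λ y → s * (y + y)) y₁≡0) (*-zeroʳ s)))
    where
    open IsSum P
    y₁≡0 = -p≡p⇒p≡0 y₁ (trans y₁≡-y₂ (cong -_ (trans (sym P₂∈) P₁∈)))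

  isSum⇒⊕ : ∀ {x₁ y₁ x₂ y₂ x₃ y₃} .(on₁ : OnCurve x₁ y₁) .(on₂ : OnCurve x₂ y₂) .(on₃ : OnCurve x₃ y₃) →
            IsSum x₁ y₁ x₂ y₂ x₃ y₃ →
            affine x₁ y₁ on₁ ⊕ affine x₂ y₂ on₂ ≡ affine x₃ y₃ on₃
  isSum⇒⊕ {x₁} {y₁} {x₂} {y₂} on₁ on₂ on₃ P with x₁ ≟ x₂ | y₁ ≟ - y₂
  ... | no x₁≢x₂ | _           = affine-third P (chordSlope-unique x₁≢x₂ P) _ on₃
  ... | yes refl | yes y₁≡-y₂  = contradiction y₁≡-y₂ (no-vertical-line (recompute-onCurve x₁ y₁ on₁) P)
  ... | yes refl | no y₁≢-y₂   =
    affine-third P (tangentSlope-unique (2y≢0 x₁ y₁ x₁ y₂ on₁ on₂ refl y₁≢-y₂) P) _ on₃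

  -- The common part of chord and tangent. `e₁` holds by the choice of x₃, and `e₃` follows from
  -- `e₂` since x₁ is a root of the cubic. Only `e₂` differs: for a chord it is the difference of
  -- two curve equations divided by x₂ - x₁, for a tangent it is the slope equation.
  isSum-third : ∀ x₁ y₁ x₂ y₂ s → OnCurve x₁ y₁ → let x₃ = thirdX s x₁ x₂; ν = y₁ - s * x₁ in
    s * (x₂ - x₁) ≡ y₂ - y₁ →
    x₁ * x₂ + x₁ * x₃ + x₂ * x₃ + A² + (s * ν + s * ν) ≡ 0ℚ →
    IsSum x₁ y₁ x₂ y₂ x₃ (thirdY s x₁ y₁ x₃)
  isSum-third x₁ y₁ x₂ y₂ s on slope e₂ = line s ν
    (solve 3 (λ s x₁ y₁ → s :* x₁ :+ (y₁ :- s :* x₁) := y₁) refl s x₁ y₁)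
    (begin
      s * x₂ + (y₁ - s * x₁)
        ≡⟨ solve 4 (λ s x₁ x₂ y₁ → s :* x₂ :+ (y₁ :- s :* x₁) :=
             s :* (x₂ :- x₁) :+ y₁) refl s x₁ x₂ y₁ ⟩
      s * (x₂ - x₁) + y₁      ≡⟨ cong (_+ y₁) slope ⟩
      y₂ - y₁ + y₁            ≡⟨ solve 2 (λ y₁ y₂ → y₂ :- y₁ :+ y₁ := y₂) refl y₁ y₂ ⟩
      y₂                      ∎)
    (solve 4 (λ s x₁ x₃ y₁ → s :* x₃ :+ (y₁ :- s :* x₁) :=
         :- (s :* (x₁ :- x₃) :- y₁)) refl s x₁ x₃ y₁)
    (solve 3 (λ s x₁ x₂ → x₁ :+ x₂ :+ (s :* s :- x₁ :- x₂) := s :* s) refl s x₁ x₂)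
    e₂
    (p-q≡0⇒p≡q _ _ (begin
      x₁ * x₂ * x₃ - ν * ν
        ≡⟨ solve 5 (λ s x₁ x₂ y₁ a → let x₃ = s :* s :- x₁ :- x₂; ν = y₁ :- s :* x₁ in
             x₁ :* x₂ :* x₃ :- ν :* ν :=
             x₁ :* x₁ :* x₁ :- a :* x₁ :- y₁ :* y₁
             :+ x₁ :* (x₁ :* x₂ :+ x₁ :* x₃ :+ x₂ :* x₃ :+ a :+ (s :* ν :+ s :* ν))) refl s x₁ x₂ y₁ A² ⟩
      x₁ * x₁ * x₁ - A² * x₁ - y₁ * y₁
      + x₁ * (x₁ * x₂ + x₁ * x₃ + x₂ * x₃ + A² + (s * ν + s * ν))
        ≡⟨ cong₂ (λ u v → u + x₁ * v) (onCurve⇒0 x₁ y₁ on) e₂ ⟩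
      0ℚ + x₁ * 0ℚ
        ≡⟨ solve 1 (λ x → con 0ℚ :+ x :* con 0ℚ := con 0ℚ) refl x₁ ⟩
      0ℚ ∎))
    where
    x₃ = thirdX s x₁ x₂
    ν  = y₁ - s * x₁

  chord-isSum : ∀ x₁ y₁ x₂ y₂ s → OnCurve x₁ y₁ → OnCurve x₂ y₂ → x₁ ≢ x₂ →
    s * (x₂ - x₁) ≡ y₂ - y₁ →
    IsSum x₁ y₁ x₂ y₂ (thirdX s x₁ x₂) (thirdY s x₁ y₁ (thirdX s x₁ x₂))
  chord-isSum x₁ y₁ x₂ y₂ s on₁ on₂ x₁≢x₂ slope = isSum-third x₁ y₁ x₂ y₂ s on₁ slope
    (p*q≡0∧p≢0⇒q≡0 (x₂ - x₁) _ (p≢q⇒q-p≢0 x₁≢x₂) (begin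
      (x₂ - x₁) * (x₁ * x₂ + x₁ * x₃ + x₂ * x₃ + A² + (s * ν + s * ν))
        ≡⟨ solve 5 (λ s x₁ x₂ y₁ a → let x₃ = s :* s :- x₁ :- x₂; ν = y₁ :- s :* x₁ in
             (x₂ :- x₁) :* (x₁ :* x₂ :+ x₁ :* x₃ :+ x₂ :* x₃ :+ a :+ (s :* ν :+ s :* ν)) :=
             x₁ :* x₁ :* x₁ :- a :* x₁ :- y₁ :* y₁
             :- (x₂ :* x₂ :* x₂ :- a :* x₂
                 :- (y₁ :+ s :* (x₂ :- x₁)) :* (y₁ :+ s :* (x₂ :- x₁)))) refl s x₁ x₂ y₁ A² ⟩
      x₁ * x₁ * x₁ - A² * x₁ - y₁ * y₁
      - (x₂ * x₂ * x₂ - A² * x₂ - (y₁ + s * (x₂ - x₁)) * (y₁ + s * (x₂ - x₁)))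
        ≡⟨ cong₂ _-_ (onCurve⇒0 x₁ y₁ on₁)
             (trans (cong (λ z → x₂ * x₂ * x₂ - A² * x₂ - z * z) y₁+Δ≡y₂) (onCurve⇒0 x₂ y₂ on₂)) ⟩
      0ℚ ∎))
    where
    x₃ = thirdX s x₁ x₂
    ν  = y₁ - s * x₁
    y₁+Δ≡y₂ : y₁ + s * (x₂ - x₁) ≡ y₂
    y₁+Δ≡y₂ = trans (cong (y₁ +_) slope) (solve 2 (λ y₁ y₂ → y₁ :+ (y₂ :- y₁) := y₂) refl y₁ y₂)

  tangent-isSum : ∀ x y₁ y₂ s → OnCurve x y₁ → y₁ ≡ y₂ → s * (y₁ + y₁) ≡ x * x + x * x + x * x - A² →
    IsSum x y₁ x y₂ (thirdX s x x) (thirdY s x y₁ (thirdX s x x))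
  tangent-isSum x y y s on refl slope = isSum-third x y x y s on
    (solve 3 (λ s x y → s :* (x :- x) := y :- y) refl s x y) (begin
      x * x + x * x₃ + x * x₃ + A² + (s * ν + s * ν)
        ≡⟨ solve 4 (λ s x y a → let x₃ = s :* s :- x :- x; ν = y :- s :* x in
             x :* x :+ x :* x₃ :+ x :* x₃ :+ a :+ (s :* ν :+ s :* ν) :=
             s :* (y :+ y) :- (x :* x :+ x :* x :+ x :* x :- a)) refl s x y A² ⟩
      s * (y + y) - (x * x + x * x + x * x - A²)  ≡⟨ p≡q⇒p-q≡0 slope ⟩
      0ℚ                                          ∎)
    where
    x₃ = thirdX s x x
    ν  = y - s * x

  -- The graph of `_⊕_` on affine points, with chord and tangent merged. Together with `isSum⇒⊕` it
  -- replaces the case analysis of the group law by reasoning about `IsSum`.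
  data SumView : Point → Point → Point → Set where
    inverse : ∀ {x y₁ y₂} .{on₁ on₂} → y₂ ≡ - y₁ → SumView (affine x y₁ on₁) (affine x y₂ on₂) 𝒪
    sum     : ∀ {x₁ y₁ x₂ y₂ x₃ y₃} .{on₁ on₂ on₃} → IsSum x₁ y₁ x₂ y₂ x₃ y₃ →
              SumView (affine x₁ y₁ on₁) (affine x₂ y₂ on₂) (affine x₃ y₃ on₃)

  sumView : ∀ {x₁ y₁ x₂ y₂} .(on₁ : OnCurve x₁ y₁) .(on₂ : OnCurve x₂ y₂) →
            let P = affine x₁ y₁ on₁; Q = affine x₂ y₂ on₂ in SumView P Q (P ⊕ Q)
  sumView {x₁} {y₁} {x₂} {y₂} on₁ on₂ with x₁ ≟ x₂ | y₁ ≟ - y₂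
  ... | no x₁≢x₂ | _ = sum (chord-isSum x₁ y₁ x₂ y₂ (chordSlope x₁ y₁ x₂ y₂ x₁≢x₂)
    (recompute-onCurve x₁ y₁ on₁) (recompute-onCurve x₂ y₂ on₂) x₁≢x₂
    (p÷q*q≡p (y₂ - y₁) (x₂ - x₁) {{≢-nonZero (p≢q⇒q-p≢0 x₁≢x₂)}}))
  ... | yes refl | yes y₁≡-y₂ = inverse (trans (solve 1 (λ y → y :=
       :- (:- y)) refl y₂) (cong -_ (sym y₁≡-y₂)))
  ... | yes refl | no y₁≢-y₂ = sum (tangent-isSum x₁ y₁ y₂
    (tangentSlope x₁ y₁ (2y≢0 x₁ y₁ x₁ y₂ on₁ on₂ refl y₁≢-y₂)) (recompute-onCurve x₁ y₁ on₁)
    (square-injective (trans (recompute-onCurve x₁ y₁ on₁) (sym (recompute-onCurve x₁ y₂ on₂))) y₁≢-y₂)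
    (p÷q*q≡p (x₁ * x₁ + x₁ * x₁ + x₁ * x₁ - A²) (y₁ + y₁)
      {{≢-nonZero (2y≢0 x₁ y₁ x₁ y₂ on₁ on₂ refl y₁≢-y₂)}}))

  ⊖-involutive : ∀ P → ⊖ ⊖ P ≡ P
  ⊖-involutive 𝒪               = refl
  ⊖-involutive (affine x y on) = affine-cong _ on refl (-‿involutive y)

  vertical : ∀ {x y₁ y₂} .(on₁ : OnCurve x y₁) .(on₂ : OnCurve x y₂) → y₁ ≡ - y₂ →
             affine x y₁ on₁ ⊕ affine x y₂ on₂ ≡ 𝒪
  vertical {x} {y₁} {y₂} on₁ on₂ y₁≡-y₂ with x ≟ x | y₁ ≟ - y₂
  ... | no x≢x | _           = contradiction refl x≢x
  ... | yes _  | yes _       = refl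
  ... | yes _  | no y₁≢-y₂   = contradiction y₁≡-y₂ y₁≢-y₂

  ⊕-inverseˡ : ∀ P → ⊖ P ⊕ P ≡ 𝒪
  ⊕-inverseˡ 𝒪               = refl
  ⊕-inverseˡ (affine x y on) = vertical _ on refl

  ⊕-cancelˡ : ∀ P Q → ⊖ P ⊕ (P ⊕ Q) ≡ Q
  ⊕-cancelˡ 𝒪 Q = refl
  ⊕-cancelˡ P@(affine _ _ _) 𝒪 = ⊕-inverseˡ P
  ⊕-cancelˡ P@(affine x₁ y₁ on₁) Q@(affine _ _ on₂) = go (sumView on₁ on₂)
    where
    go : ∀ {Q R} → SumView P Q R → ⊖ P ⊕ R ≡ Q
    go (inverse {on₂ = on₂} y₂≡-y₁)     = affine-cong _ on₂ refl (sym y₂≡-y₁)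
    go (sum {on₂ = on₂} {on₃ = on₃} P+Q≡R) = isSum⇒⊕ _ on₃ on₂ (isSum-cancel P+Q≡R)

  ⊖-homo-⊕ : ∀ P Q → ⊖ (P ⊕ Q) ≡ ⊖ P ⊕ ⊖ Q
  ⊖-homo-⊕ 𝒪 Q = refl
  ⊖-homo-⊕ (affine _ _ _) 𝒪 = refl
  ⊖-homo-⊕ P@(affine x₁ y₁ on₁) Q@(affine _ _ on₂) = go (sumView on₁ on₂)
    where
    go : ∀ {Q R} → SumView P Q R → ⊖ R ≡ ⊖ P ⊕ ⊖ Q
    go (inverse y₂≡-y₁) = sym (vertical _ _ (trans (sym y₂≡-y₁) (sym (-‿involutive _))))
    go (sum P+Q≡R)      = sym (isSum⇒⊕ _ _ _ (isSum-⊖ P+Q≡R))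

  -- Copies of P are moved across one at a time, each by cancelling ⊖ P. The case i = j shows that
  -- half of a vanishing even multiple is its own inverse.
  ·-complement : ∀ P {n} → n · P ≡ 𝒪 → ∀ i j → i ℕ.+ j ≡ n → i · P ≡ ⊖ (j · P)
  ·-complement P nP≡𝒪 zero    j refl    = sym (cong ⊖_ nP≡𝒪)
  ·-complement P nP≡𝒪 (suc i) j i+1+j≡n = begin
    P ⊕ i · P
      ≡⟨ cong (P ⊕_) (·-complement P nP≡𝒪 i (suc j) (trans (ℕ.+-suc i j) i+1+j≡n)) ⟩
    P ⊕ ⊖ (P ⊕ j · P)    ≡⟨ cong (P ⊕_) (⊖-homo-⊕ P (j · P)) ⟩
    P ⊕ (⊖ P ⊕ ⊖ (j · P))  ≡⟨ cong (_⊕ (⊖ P ⊕ ⊖ (j · P))) (⊖-involutive P) ⟨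
    ⊖ ⊖ P ⊕ (⊖ P ⊕ ⊖ (j · P))  ≡⟨ ⊕-cancelˡ (⊖ P) (⊖ (j · P)) ⟩
    ⊖ (j · P)            ∎

  ·-∸ : ∀ P i j → (i ℕ.+ j) · P ≡ i · P → j · P ≡ 𝒪
  ·-∸ P zero    j eq = eq
  ·-∸ P (suc i) j eq = ·-∸ P i j (begin
    (i ℕ.+ j) · P                ≡⟨ ⊕-cancelˡ P _ ⟨
    ⊖ P ⊕ (P ⊕ (i ℕ.+ j) · P)    ≡⟨ cong (⊖ P ⊕_) eq ⟩
    ⊖ P ⊕ (P ⊕ i · P)            ≡⟨ ⊕-cancelˡ P _ ⟩
    i · P                        ∎)

  self-inverse : ∀ {x y} .{on} → affine x y on ≡ ⊖ affine x y on → y ≡ 0ℚ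
  self-inverse {y = y} eq = -p≡p⇒p≡0 y (ordinates eq)
    where
    ordinates : ∀ {x₁ y₁ x₂ y₂} .{on₁ on₂} → affine x₁ y₁ on₁ ≡ affine x₂ y₂ on₂ → y₁ ≡ y₂
    ordinates refl = refl

  data OffAxis : Point → Set where
    offAxis : ∀ {x y} .{on} → y ≢ 0ℚ → OffAxis (affine x y on)

  -- The odd multiples are the source of the triples, whose sides are quotients by y.
  record NonTorsion (P : Point) : Set where
    field
      infinite-order : ∀ n → suc n · P ≢ 𝒪
      odd-multiples  : ∀ n → OffAxis (suc (n ℕ.+ n) · P)

-- The Jacobi quartic

module Quartic (b c : ℚ) where
  q : ℚ → ℚ
  q x = x * x + b * x + c

  d : ℚ
  d = b * b - (c + c + c + c)

  -- Both quotients X / y and y / q in division-free form. They remain meaningful at X = y = 0,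
  -- where c ≠ 0 forces ζ = 0.
  record IsZeta (x y ζ : ℚ) : Set where
    constructor zeta
    field
      x≡ζy : x ≡ ζ * y
      y≡ζq : y ≡ ζ * q x

  -- The equations are oriented so that matching on `refl` eliminates the ordinates, b and c. What
  -- remains is s, ν and the abscissae, subject to the single relation `e₃`.
  record IsLine (s ν x₁ y₁ x₂ y₂ x₃ y₃ : ℚ) : Set where
    constructor line
    field
      P₁∈ : y₁ ≡ s * x₁ + ν
      P₂∈ : y₂ ≡ s * x₂ + ν
      P₃∈ : y₃ ≡ - (s * x₃ + ν)
      e₁  : b ≡ s * s - x₁ - x₂ - x₃
      e₂  : c ≡ x₁ * x₂ + x₁ * x₃ + x₂ * x₃ + (s * ν + s * ν)
      e₃  : ν * ν - x₁ * x₂ * x₃ ≡ 0ℚ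

  q≢0 : ∀ {x y ζ} → c ≢ 0ℚ → IsZeta x y ζ → q x ≢ 0ℚ
  q≢0 {x} {y} {ζ} c≢0 (zeta x≡ζy y≡ζq) q≡0 = c≢0 (begin
    c
      ≡⟨ solve 2 (λ b c → c := con 0ℚ :* con 0ℚ :+ b :* con 0ℚ :+ c) refl b c ⟩
    0ℚ * 0ℚ + b * 0ℚ + c    ≡⟨ cong (λ x → x * x + b * x + c) x≡0 ⟨
    q x                     ≡⟨ q≡0 ⟩
    0ℚ                      ∎)
    where
    y≡0 : y ≡ 0ℚ
    y≡0 = trans y≡ζq (trans (cong (ζ *_) q≡0) (*-zeroʳ ζ))
    x≡0 : x ≡ 0ℚ
    x≡0 = trans x≡ζy (trans (cong (ζ *_) y≡0) (*-zeroʳ ζ))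

  ζζq≡x : ∀ {x y ζ} → IsZeta x y ζ → ζ * ζ * q x ≡ x
  ζζq≡x {x} {y} {ζ} (zeta x≡ζy y≡ζq) = begin
    ζ * ζ * q x    ≡⟨ *-assoc ζ ζ (q x) ⟩
    ζ * (ζ * q x)  ≡⟨ cong (ζ *_) y≡ζq ⟨
    ζ * y          ≡⟨ x≡ζy ⟨
    x              ∎

  -- (x² - c)² = q² - 2bxq + dx² holds identically; dividing by q² and using ζ² = x / q gives the
  -- quartic.
  quartic : ∀ {x y ζ δ} → c ≢ 0ℚ → IsZeta x y ζ → δ * q x ≡ x * x - c →
            δ * δ ≡ 1ℚ - (b * (ζ * ζ) + b * (ζ * ζ)) + d * (ζ * ζ * (ζ * ζ))
  quartic {x} {y} {ζ} {δ} c≢0 isζ δq≡x²-c = *-cancelˡ-≢0 (p*q≢0 (q≢0 c≢0 isζ) (q≢0 c≢0 isζ)) (begin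
    q x * q x * (δ * δ)
      ≡⟨ solve 2 (λ q δ → q :* q :* (δ :* δ) := δ :* q :* (δ :* q)) refl (q x) δ ⟩
    δ * q x * (δ * q x)
      ≡⟨ cong (λ z → z * z) δq≡x²-c ⟩
    (x * x - c) * (x * x - c)
      ≡⟨ solve 3 (λ x b c → let q = x :* x :+ b :* x :+ c in
           (x :* x :- c) :* (x :* x :- c) :=
           q :* q :- (b :* x :* q :+ b :* x :* q) :+ (b :* b :- (c :+ c :+ c :+ c)) :* (x :* x)) refl x b c ⟩
    q x * q x - (b * x * q x + b * x * q x) + d * (x * x)
      ≡⟨ cong (λ z → q x * q x - (b * z * q x + b * z * q x) + d * (z * z)) (ζζq≡x isζ) ⟨
    q x * q x - (b * (ζ * ζ * q x) * q x + b * (ζ * ζ * q x) * q x)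
    + d * (ζ * ζ * q x * (ζ * ζ * q x))
      ≡⟨ solve 4 (λ q b d z →
           q :* q :- (b :* (z :* q) :* q :+ b :* (z :* q) :* q) :+ d :* (z :* q :* (z :* q)) :=
           q :* q :* (con 1ℚ :- (b :* z :+ b :* z) :+ d :* (z :* z))) refl (q x) b d (ζ * ζ) ⟩
    q x * q x * (1ℚ - (b * (ζ * ζ) + b * (ζ * ζ)) + d * (ζ * ζ * (ζ * ζ))) ∎)

  -- `num` and `den` are the numerator and denominator of the addition formula for ζ, each
  -- multiplied by q(x₁) q(x₂).
  num : (x₁ y₁ x₂ y₂ : ℚ) → ℚ
  num x₁ y₁ x₂ y₂ = y₁ * (x₂ * x₂ - c) + y₂ * (x₁ * x₁ - c)

  den : (x₁ x₂ : ℚ) → ℚ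
  den x₁ x₂ = q x₁ * q x₂ - d * (x₁ * x₂)

  -- With b and c eliminated by e₁ and e₂, the next three differences are divisible
  -- by ν² - x₁x₂x₃; r is the quotient.
  den*x₃≡num*y₃ : ∀ {s ν x₁ y₁ x₂ y₂ x₃ y₃} → IsLine s ν x₁ y₁ x₂ y₂ x₃ y₃ →
                  den x₁ x₂ * x₃ ≡ num x₁ y₁ x₂ y₂ * y₃
  den*x₃≡num*y₃ {s} {ν} {x₁} {x₂ = x₂} {x₃ = x₃} (line refl refl refl refl refl e₃) =
    p-q≡0⇒p≡q _ _ (p≡r*s∧s≡0⇒p≡0
    {r = (x₁ * x₁ + x₂ * x₂ - 2ℚ * (x₁ * x₂ + x₁ * x₃ + x₂ * x₃ + s * s * (x₁ + x₂) + 2ℚ * (s * ν)))}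
    (solve 5 (λ x₁ x₂ x₃ s ν → let
      b = s :* s :- x₁ :- x₂ :- x₃
      c = x₁ :* x₂ :+ x₁ :* x₃ :+ x₂ :* x₃ :+ (s :* ν :+ s :* ν)
      q = λ x → x :* x :+ b :* x :+ c
      num = (s :* x₁ :+ ν) :* (x₂ :* x₂ :- c) :+ (s :* x₂ :+ ν) :* (x₁ :* x₁ :- c)
      den = q x₁ :* q x₂ :- (b :* b :- (c :+ c :+ c :+ c)) :* (x₁ :* x₂)
      in den :* x₃ :- num :* (:- (s :* x₃ :+ ν)) :=
        (x₁ :* x₁ :+ x₂ :* x₂
         :- con 2ℚ :* (x₁ :* x₂ :+ x₁ :* x₃ :+ x₂ :* x₃ :+ s :* s :* (x₁ :+ x₂) :+ con 2ℚ :* (s :* ν)))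
        :* (ν :* ν :- x₁ :* x₂ :* x₃)) refl x₁ x₂ x₃ s ν)
    e₃)
    where 2ℚ = 1ℚ + 1ℚ

  den*y₃≡num*q₃ : ∀ {s ν x₁ y₁ x₂ y₂ x₃ y₃} → IsLine s ν x₁ y₁ x₂ y₂ x₃ y₃ →
                  den x₁ x₂ * y₃ ≡ num x₁ y₁ x₂ y₂ * q x₃
  den*y₃≡num*q₃ {s} {ν} {x₁} {x₂ = x₂} {x₃ = x₃} (line refl refl refl refl refl e₃) =
    p-q≡0⇒p≡q _ _ (p≡r*s∧s≡0⇒p≡0
    {r = 2ℚ * s * (x₁ * x₃ + s * s * x₁ - x₁ * x₁ - x₂ * x₂ + x₂ * x₃ + s * s * x₂ + 2ℚ * (s * ν))}
    (solve 5 (λ x₁ x₂ x₃ s ν → let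
      b = s :* s :- x₁ :- x₂ :- x₃
      c = x₁ :* x₂ :+ x₁ :* x₃ :+ x₂ :* x₃ :+ (s :* ν :+ s :* ν)
      q = λ x → x :* x :+ b :* x :+ c
      num = (s :* x₁ :+ ν) :* (x₂ :* x₂ :- c) :+ (s :* x₂ :+ ν) :* (x₁ :* x₁ :- c)
      den = q x₁ :* q x₂ :- (b :* b :- (c :+ c :+ c :+ c)) :* (x₁ :* x₂)
      in den :* (:- (s :* x₃ :+ ν)) :- num :* q x₃ :=
        con 2ℚ :* s :* (x₁ :* x₃ :+ s :* s :* x₁ :- x₁ :* x₁ :- x₂ :* x₂
          :+ x₂ :* x₃ :+ s :* s :* x₂ :+ con 2ℚ :* (s :* ν))
        :* (ν :* ν :- x₁ :* x₂ :* x₃)) refl x₁ x₂ x₃ s ν)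
    e₃)
    where 2ℚ = 1ℚ + 1ℚ

  -- If α and β are the roots of q, comparing X q(X) - (sX + ν)² with the product of the X - xᵢ at X
  -- = α shows that the product of the xᵢ - α is (sα + ν)². Multiplying by the same at β gives n²,
  -- where n = (sα + ν)(sβ + ν) is the norm of the line.
  qqq≡square : ∀ {s ν x₁ y₁ x₂ y₂ x₃ y₃} → IsLine s ν x₁ y₁ x₂ y₂ x₃ y₃ →
               let n = ν * ν - b * (s * ν) + c * (s * s) in q x₁ * q x₂ * q x₃ ≡ n * n
  qqq≡square {s} {ν} {x₁} {x₂ = x₂} {x₃ = x₃} (line refl refl refl refl refl e₃) =
    p-q≡0⇒p≡q _ _ (p≡r*s∧s≡0⇒p≡0
    {r = (s * s * (2ℚ * (s * s) * (x₁ + x₂ + x₃) - x₁ * x₁ - x₂ * x₂ - x₃ * x₃)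
          - 2ℚ * (s * ν * (x₁ + x₂ + x₃)) - x₁ * x₂ * x₃ - s * s * s * s * s * s + 6ℚ * (s * s * s * ν) - ν * ν)}
    (solve 5 (λ x₁ x₂ x₃ s ν → let
      b = s :* s :- x₁ :- x₂ :- x₃
      c = x₁ :* x₂ :+ x₁ :* x₃ :+ x₂ :* x₃ :+ (s :* ν :+ s :* ν)
      q = λ x → x :* x :+ b :* x :+ c
      n = ν :* ν :- b :* (s :* ν) :+ c :* (s :* s)
      in q x₁ :* q x₂ :* q x₃ :- n :* n :=
        (s :* s :* (con 2ℚ :* (s :* s) :* (x₁ :+ x₂ :+ x₃) :- x₁ :* x₁ :- x₂ :* x₂ :- x₃ :* x₃)
         :- con 2ℚ :* (s :* ν :* (x₁ :+ x₂ :+ x₃)) :- x₁ :* x₂ :* x₃ :- s :* s :* s :* s :* s :* s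
         :+ con 6ℚ :* (s :* s :* s :* ν) :- ν :* ν)
        :* (ν :* ν :- x₁ :* x₂ :* x₃)) refl x₁ x₂ x₃ s ν)
    e₃)
    where
    2ℚ = 1ℚ + 1ℚ
    6ℚ = 2ℚ + 2ℚ + 2ℚ

  -- Multiplied by q(x₁) q(x₂), the formula reads num = den ζ₃. Cancelling `den` in the two
  -- polynomial identities yields both equations of `IsZeta`, whether or not y₃ vanishes.
  addition : ∀ {s ν x₁ y₁ x₂ y₂ x₃ y₃ ζ₁ ζ₂ ζ₃ δ₁ δ₂} → c ≢ 0ℚ →
    IsLine s ν x₁ y₁ x₂ y₂ x₃ y₃ →
    IsZeta x₁ y₁ ζ₁ → δ₁ * q x₁ ≡ x₁ * x₁ - c →
    IsZeta x₂ y₂ ζ₂ → δ₂ * q x₂ ≡ x₂ * x₂ - c →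
    1ℚ - d * (ζ₁ * ζ₁ * (ζ₂ * ζ₂)) ≢ 0ℚ →
    ζ₃ * (1ℚ - d * (ζ₁ * ζ₁ * (ζ₂ * ζ₂))) ≡ ζ₁ * δ₂ + ζ₂ * δ₁ →
    IsZeta x₃ y₃ ζ₃
  addition {s} {ν} {x₁} {y₁} {x₂} {y₂} {x₃} {y₃} {ζ₁} {ζ₂} {ζ₃} {δ₁} {δ₂} c≢0 ℓ isζ₁ δ₁q≡ isζ₂ δ₂q≡ κ≢0 ζ₃κ≡ =
    zeta (*-cancelˡ-≢0 den≢0 (trans (den*x₃≡num*y₃ ℓ) (scale y₃)))
         (*-cancelˡ-≢0 den≢0 (trans (den*y₃≡num*q₃ ℓ) (scale (q x₃))))
    where
    κ = 1ℚ - d * (ζ₁ * ζ₁ * (ζ₂ * ζ₂))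

    den≡qqκ : den x₁ x₂ ≡ q x₁ * q x₂ * κ
    den≡qqκ = begin
      q x₁ * q x₂ - d * (x₁ * x₂)
        ≡⟨ cong₂ (λ u v → q x₁ * q x₂ - d * (u * v)) (ζζq≡x isζ₁) (ζζq≡x isζ₂) ⟨
      q x₁ * q x₂ - d * (ζ₁ * ζ₁ * q x₁ * (ζ₂ * ζ₂ * q x₂))
        ≡⟨ solve 5 (λ q₁ q₂ d z₁ z₂ → q₁ :* q₂ :- d :* (z₁ :* q₁ :* (z₂ :* q₂)) :=
             q₁ :* q₂ :* (con 1ℚ :- d :* (z₁ :* z₂))) refl (q x₁) (q x₂) d (ζ₁ * ζ₁) (ζ₂ * ζ₂) ⟩
      q x₁ * q x₂ * κ ∎

    den≢0 : den x₁ x₂ ≢ 0ℚ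
    den≢0 eq = p*q≢0 (p*q≢0 (q≢0 c≢0 isζ₁) (q≢0 c≢0 isζ₂)) κ≢0 (trans (sym den≡qqκ) eq)

    num≡denζ₃ : num x₁ y₁ x₂ y₂ ≡ den x₁ x₂ * ζ₃
    num≡denζ₃ = begin
      y₁ * (x₂ * x₂ - c) + y₂ * (x₁ * x₁ - c)
        ≡⟨ cong₂ (λ u v → y₁ * u + y₂ * v) δ₂q≡ δ₁q≡ ⟨
      y₁ * (δ₂ * q x₂) + y₂ * (δ₁ * q x₁)
        ≡⟨ cong₂ (λ u v → u * (δ₂ * q x₂) + v * (δ₁ * q x₁)) (IsZeta.y≡ζq isζ₁) (IsZeta.y≡ζq isζ₂) ⟩
      ζ₁ * q x₁ * (δ₂ * q x₂) + ζ₂ * q x₂ * (δ₁ * q x₁)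
        ≡⟨ solve 6 (λ q₁ q₂ z₁ z₂ d₁ d₂ → z₁ :* q₁ :* (d₂ :* q₂) :+ z₂ :* q₂ :* (d₁ :* q₁) :=
             q₁ :* q₂ :* (z₁ :* d₂ :+ z₂ :* d₁)) refl (q x₁) (q x₂) ζ₁ ζ₂ δ₁ δ₂ ⟩
      q x₁ * q x₂ * (ζ₁ * δ₂ + ζ₂ * δ₁)
        ≡⟨ cong (q x₁ * q x₂ *_) ζ₃κ≡ ⟨
      q x₁ * q x₂ * (ζ₃ * κ)
        ≡⟨ solve 3 (λ q z k → q :* (z :* k) := q :* k :* z) refl (q x₁ * q x₂) ζ₃ κ ⟩
      q x₁ * q x₂ * κ * ζ₃
        ≡⟨ cong (_* ζ₃) den≡qqκ ⟨
      den x₁ x₂ * ζ₃ ∎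

    scale : ∀ z → num x₁ y₁ x₂ y₂ * z ≡ den x₁ x₂ * (ζ₃ * z)
    scale z = trans (cong (_* z) num≡denζ₃) (*-assoc (den x₁ x₂) ζ₃ z)

-- 2-adic descent along the multiples of a point.

module Descent
  (A : ℕ) (A²≢0 : fromℕ A * fromℕ A ≢ 0ℚ)
  (ε : ℚ) (ε³≡ε : ε * ε * ε ≡ ε) {π : Parity} (ε-integral : HasParity π ε)
  (c-nonsquare : ∀ t → t * t ≢ (ε * ε + ε * ε + ε * ε - 1ℚ) * (fromℕ A * fromℕ A))
  {x₀ y₀ z : ℚ} (on₀ : CongruentNumberCurve.OnCurve A x₀ y₀) (y₀≢0 : y₀ ≢ 0ℚ)
  (x₀-e≡zy₀ : x₀ - ε * fromℕ A ≡ z * y₀)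
  (Azz-even : HasParity 0ℙ (fromℕ A * (z * z)))
  where

  open CongruentNumberCurve A
  open GroupLaw A A²≢0

  -- The equation ε³ = ε treats the three roots e = εA at once; b and c are the Taylor coefficients
  -- of x³ - A²x at e.
  a e b c : ℚ
  a = fromℕ A
  e = ε * a
  b = (ε + ε + ε) * a
  c = (ε * ε + ε * ε + ε * ε - 1ℚ) * A²

  open Quartic b c

  c≢0 : c ≢ 0ℚ
  c≢0 c≡0 = c-nonsquare 0ℚ (sym c≡0)

  onCurve⇒yy≡xq : ∀ x y → OnCurve x y → y * y ≡ (x - e) * q (x - e)
  onCurve⇒yy≡xq x y on = trans on (p-q≡0⇒p≡q _ _ (p≡r*s∧s≡0⇒p≡0 {r = a * a * a}
    (solve 3 (λ x a ε → let e = ε :* a; X = x :- e in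
      x :* x :* x :- a :* a :* x :- X :* (X :* X :+ (ε :+ ε :+ ε) :* a :* X
        :+ (ε :* ε :+ ε :* ε :+ ε :* ε :- con 1ℚ) :* (a :* a)) :=
      a :* a :* a :* (ε :* ε :* ε :- ε)) refl x a ε)
    (p≡q⇒p-q≡0 ε³≡ε)))

  -- The translation x = X + e keeps the slope and moves the intercept to ν + se. That e is a root
  -- matters for the constant coefficient `e₃`.
  isSum⇒isLine : ∀ {x₁ y₁ x₂ y₂ x₃ y₃} (P : IsSum x₁ y₁ x₂ y₂ x₃ y₃) → let open IsSum P in
    IsLine s (ν + s * e) (x₁ - e) y₁ (x₂ - e) y₂ (x₃ - e) y₃
  isSum⇒isLine {x₁} {y₁} {x₂} {y₂} {x₃} {y₃} (line s ν P₁∈ P₂∈ P₃∈ e₁ e₂ e₃) = line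
    (shift P₁∈) (shift P₂∈)
    (trans (sym (-‿involutive y₃)) (cong -_ (shift P₃∈)))
    (p-q≡0⇒p≡q _ _ (trans
      (solve 6 (λ a ε x₁ x₂ x₃ s → let e = ε :* a in
        (ε :+ ε :+ ε) :* a :- (s :* s :- (x₁ :- e) :- (x₂ :- e) :- (x₃ :- e)) :=
        x₁ :+ x₂ :+ x₃ :- s :* s) refl a ε x₁ x₂ x₃ s)
      (p≡q⇒p-q≡0 e₁)))
    (p-q≡0⇒p≡q _ _ (begin
      c - ((x₁ - e) * (x₂ - e) + (x₁ - e) * (x₃ - e) + (x₂ - e) * (x₃ - e)
           + (s * (ν + s * e) + s * (ν + s * e)))
        ≡⟨ solve 7 (λ a ε x₁ x₂ x₃ s ν → let e = ε :* a in
             (ε :* ε :+ ε :* ε :+ ε :* ε :- con 1ℚ) :* (a :* a)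
             :- ((x₁ :- e) :* (x₂ :- e) :+ (x₁ :- e) :* (x₃ :- e) :+ (x₂ :- e) :* (x₃ :- e)
                 :+ (s :* (ν :+ s :* e) :+ s :* (ν :+ s :* e))) :=
             (e :+ e) :* (x₁ :+ x₂ :+ x₃ :- s :* s)
             :- (x₁ :* x₂ :+ x₁ :* x₃ :+ x₂ :* x₃ :+ a :* a :+ (s :* ν :+ s :* ν)))
             refl a ε x₁ x₂ x₃ s ν ⟩
      (e + e) * (x₁ + x₂ + x₃ - s * s)
      - (x₁ * x₂ + x₁ * x₃ + x₂ * x₃ + A² + (s * ν + s * ν))
        ≡⟨ cong₂ (λ u v → (e + e) * u - v) (p≡q⇒p-q≡0 e₁) e₂ ⟩
      (e + e) * 0ℚ - 0ℚ
        ≡⟨ solve 1 (λ e → (e :+ e) :* con 0ℚ :- con 0ℚ := con 0ℚ) refl e ⟩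
      0ℚ ∎))
    (begin
      (ν + s * e) * (ν + s * e) - (x₁ - e) * (x₂ - e) * (x₃ - e)
        ≡⟨ solve 7 (λ a ε x₁ x₂ x₃ s ν → let e = ε :* a in
             (ν :+ s :* e) :* (ν :+ s :* e) :- (x₁ :- e) :* (x₂ :- e) :* (x₃ :- e) :=
             e :* (x₁ :* x₂ :+ x₁ :* x₃ :+ x₂ :* x₃ :+ a :* a :+ (s :* ν :+ s :* ν))
             :- e :* e :* (x₁ :+ x₂ :+ x₃ :- s :* s)
             :- (x₁ :* x₂ :* x₃ :- ν :* ν)
             :+ a :* a :* a :* (ε :* ε :* ε :- ε)) refl a ε x₁ x₂ x₃ s ν ⟩
      e * (x₁ * x₂ + x₁ * x₃ + x₂ * x₃ + A² + (s * ν + s * ν))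
      - e * e * (x₁ + x₂ + x₃ - s * s)
      - (x₁ * x₂ * x₃ - ν * ν)
      + a * a * a * (ε * ε * ε - ε)
        ≡⟨ cong₂ _+_ (cong₂ _-_ (cong₂ (λ u v → e * u - e * e * v) e₂ (p≡q⇒p-q≡0 e₁)) (p≡q⇒p-q≡0 e₃))
             (cong (a * a * a *_) (p≡q⇒p-q≡0 ε³≡ε)) ⟩
      e * 0ℚ - e * e * 0ℚ - 0ℚ + a * a * a * 0ℚ
        ≡⟨ solve 2 (λ e a → e :* con 0ℚ :- e :* e :* con 0ℚ :- con 0ℚ :+ a :* a :* a :* con 0ℚ :=
             con 0ℚ) refl e a ⟩
      0ℚ ∎)
    where
    shift : ∀ {x y} → s * x + ν ≡ y → y ≡ s * (x - e) + (ν + s * e)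
    shift {x} eq = trans (sym eq)
      (solve 4 (λ s x ν e → s :* x :+ ν := s :* (x :- e) :+ (ν :+ s :* e)) refl s x ν e)

  X₀ : ℚ
  X₀ = x₀ - e

  isZeta₀ : IsZeta X₀ y₀ z
  isZeta₀ = zeta x₀-e≡zy₀ (*-cancelˡ-≢0 y₀≢0 (begin
    y₀ * y₀           ≡⟨ onCurve⇒yy≡xq x₀ y₀ on₀ ⟩
    X₀ * q X₀         ≡⟨ cong (_* q X₀) x₀-e≡zy₀ ⟩
    z * y₀ * q X₀     ≡⟨ solve 3 (λ z y q → z :* y :* q := y :* (z :* q)) refl z y₀ (q X₀) ⟩
    y₀ * (z * q X₀)   ∎))

  z≢0 : z ≢ 0ℚ
  z≢0 z≡0 = y₀≢0 (trans (IsZeta.y≡ζq isZeta₀) (trans (cong (_* q X₀) z≡0) (*-zeroˡ (q X₀))))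

  bρzρz-integral : ∀ {σ ρ} → HasParity σ ρ → HasParity 0ℙ (b * (ρ * z * (ρ * z)))
  bρzρz-integral {σ} {ρ} ρ-integral = subst₂ HasParity (ℙ.*-zeroʳ ((π ℙ.+ π ℙ.+ π) ℙ.* (σ ℙ.* σ)))
    (solve 4 (λ ε ρ a z → (ε :+ ε :+ ε) :* (ρ :* ρ) :* (a :* (z :* z)) :=
      (ε :+ ε :+ ε) :* a :* (ρ :* z :* (ρ :* z))) refl ε ρ a z)
    (hasParity-* (hasParity-* (hasParity-+ (hasParity-+ ε-integral ε-integral) ε-integral)
      (hasParity-* ρ-integral ρ-integral)) Azz-even)

  -- As d = (4 - 3ε²)A², the product is (4 - 3ε²)(Az²)²κ²ρ², a 2-integral multiple of an even
  -- number.
  dzzρzρz-even : ∀ {τ σ} {κ ρ} → HasParity τ κ → HasParity σ ρ →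
                 HasParity 0ℙ (d * (κ * z * (κ * z) * (ρ * z * (ρ * z))))
  dzzρzρz-even {τ} {σ} {κ} {ρ} κ-integral ρ-integral = subst₂ HasParity
    (ℙ.*-zeroʳ ((π ℙ.* π) ℙ.+ (π ℙ.* π) ℙ.+ (π ℙ.* π)))
    (solve 5 (λ ε κ ρ a z → let
        b = (ε :+ ε :+ ε) :* a
        c = (ε :* ε :+ ε :* ε :+ ε :* ε :- con 1ℚ) :* (a :* a)
      in (con 4ℚ :- (ε :* ε :+ ε :* ε :+ ε :* ε)) :* (a :* (z :* z) :* (a :* (z :* z) :* (κ :* κ :* (ρ :* ρ)))) :=
      (b :* b :- (c :+ c :+ c :+ c)) :* (κ :* z :* (κ :* z) :* (ρ :* z :* (ρ :* z)))) refl ε κ ρ a z)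
    (hasParity-* (hasParity-- (hasParity-double (hasParity-+ hasParity-1 hasParity-1))
        (hasParity-+ (hasParity-+ εε εε) εε))
      (hasParity-* Azz-even (hasParity-* Azz-even
        (hasParity-* (hasParity-* κ-integral κ-integral) (hasParity-* ρ-integral ρ-integral)))))
    where
    4ℚ = 1ℚ + 1ℚ + (1ℚ + 1ℚ)
    εε = hasParity-* ε-integral ε-integral

  -- The quartic makes δ² equal to 1 plus even terms, and oddness passes from the square to δ.
  δ-odd : ∀ {x y ρ σ δ} → HasParity σ ρ → IsZeta x y (ρ * z) → δ * q x ≡ x * x - c → HasParity 1ℙ δ
  δ-odd {δ = δ} ρ-integral isζ δq≡ = square-odd⇒odd (subst (HasParity 1ℙ) (sym (quartic {δ = δ} c≢0 isζ δq≡))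
    (hasParity-+ (hasParity-- hasParity-1 (hasParity-double (bρzρz-integral ρ-integral)))
      (dzzρzρz-even ρ-integral ρ-integral)))

  -- Representatives of the square classes that q can take at multiples of the point: trivial at
  -- even ones, that of q(X₀) at odd ones.
  class : Parity → ℚ
  class 0ℙ = 1ℚ
  class 1ℙ = q X₀

  q₀≡class : ∀ k → class (k ℙ.⁻¹) * class k ≡ q X₀
  q₀≡class 0ℙ = *-identityʳ (q X₀)
  q₀≡class 1ℙ = *-identityˡ (q X₀)

  -- Here ρ is the ratio of ζ to its value z at P₀. Since 𝒪 occurs at `0ℙ` only, an odd level
  -- excludes it by its index alone.
  data Level : Parity → Point → Set where
    level-𝒪 : Level 0ℙ 𝒪
    level   : ∀ {k x y} .{on} ρ t → HasParity k ρ → IsZeta (x - e) y (ρ * z) →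
              q (x - e) ≡ t * t * class k → Level k (affine x y on)

  P₀ : Point
  P₀ = affine x₀ y₀ on₀

  isZeta₁ : IsZeta X₀ y₀ (1ℚ * z)
  isZeta₁ = subst (IsZeta X₀ y₀) (sym (*-identityˡ z)) isZeta₀

  Level-P₀ : Level 1ℙ P₀
  Level-P₀ = level 1ℚ 1ℚ hasParity-1 isZeta₁ (sym (*-identityˡ (q X₀)))

  q₀≢0 : q X₀ ≢ 0ℚ
  q₀≢0 = q≢0 c≢0 isZeta₀

  -- At ⊖ P₀ the equation y = ρ z q forces ρ = -1, which is odd. Thus 𝒪 can be reached from an odd
  -- level only.
  level-inverse : ∀ {k y ρ} → HasParity k ρ → IsZeta X₀ y (ρ * z) → y ≡ - y₀ → k ≡ 1ℙ
  level-inverse {1ℙ} _ _ _ = refl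
  level-inverse {0ℙ} {y} {ρ} ρ-even isζ y≡-y₀ = contradiction hasParity-1
    (hasParity-unique (subst (HasParity 0ℙ) (begin
      - ρ      ≡⟨ cong -_ ρ≡-1 ⟩
      - - 1ℚ   ≡⟨⟩
      1ℚ       ∎) (hasParity-neg ρ-even)))
    where
    ρ≡-1 : ρ ≡ - 1ℚ
    ρ≡-1 = *-cancelˡ-≢0 (p*q≢0 z≢0 q₀≢0) (begin
      z * q X₀ * ρ        ≡⟨ solve 3 (λ z q ρ → z :* q :* ρ := ρ :* z :* q) refl z (q X₀) ρ ⟩
      ρ * z * q X₀        ≡⟨ IsZeta.y≡ζq isζ ⟨
      y                   ≡⟨ y≡-y₀ ⟩
      - y₀                ≡⟨ cong -_ (IsZeta.y≡ζq isZeta₀) ⟩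
      - (z * q X₀)        ≡⟨ solve 1 (λ p → :- p := p :* con (- 1ℚ)) refl (z * q X₀) ⟩
      z * q X₀ * - 1ℚ     ∎)

  level-sum : ∀ {k x₂ y₂ x₃ y₃ ρ t} .{on₃ : OnCurve x₃ y₃} → IsSum x₀ y₀ x₂ y₂ x₃ y₃ →
    HasParity k ρ → IsZeta (x₂ - e) y₂ (ρ * z) → q (x₂ - e) ≡ t * t * class k →
    Level (k ℙ.⁻¹) (affine x₃ y₃ on₃)
  level-sum {k} {x₂} {y₂} {x₃} {y₃} {ρ} {t} P ρ-k isζ₂ q₂≡ttk = level ρ₃ t₃
    (hasParity-÷odd ρ₃-num κ-odd ρ₃κ≡) isζ₃ q₃≡
    where
    open IsSum P using (s; ν)
    ℓ = isSum⇒isLine P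
    X₂ = x₂ - e
    X₃ = x₃ - e
    q₂≢0 = q≢0 c≢0 isζ₂
    instance
      q₀-nonZero = ≢-nonZero q₀≢0
      q₂-nonZero = ≢-nonZero q₂≢0
    δ₁ = (X₀ * X₀ - c) ÷ q X₀
    δ₂ = (X₂ * X₂ - c) ÷ q X₂
    δ₁q≡ : δ₁ * q X₀ ≡ X₀ * X₀ - c
    δ₁q≡ = p÷q*q≡p _ (q X₀)
    δ₂q≡ : δ₂ * q X₂ ≡ X₂ * X₂ - c
    δ₂q≡ = p÷q*q≡p _ (q X₂)
    κ = 1ℚ - d * (1ℚ * z * (1ℚ * z) * (ρ * z * (ρ * z)))
    κ-odd : HasParity 1ℙ κ
    κ-odd = hasParity-- hasParity-1 (dzzρzρz-even hasParity-1 ρ-k)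
    κ≢0 = odd≢0 κ-odd
    instance κ-nonZero = ≢-nonZero κ≢0
    -- The addition formula with ζ₁ = z and ζ₂ = ρz, divided by z. Both δ are odd, so adding P₀
    -- flips the parity.
    ρ₃ = (δ₂ + ρ * δ₁) ÷ κ
    ρ₃κ≡ : ρ₃ * κ ≡ δ₂ + ρ * δ₁
    ρ₃κ≡ = p÷q*q≡p _ κ
    ρ₃-num : HasParity (k ℙ.⁻¹) (δ₂ + ρ * δ₁)
    ρ₃-num = subst (λ σ → HasParity (σ ℙ.⁻¹) (δ₂ + ρ * δ₁)) (ℙ.*-identityʳ k)
      (hasParity-+ (δ-odd {δ = δ₂} ρ-k isζ₂ δ₂q≡) (hasParity-* ρ-k (δ-odd {δ = δ₁} hasParity-1 isZeta₁ δ₁q≡)))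
    isζ₃ : IsZeta X₃ y₃ (ρ₃ * z)
    isζ₃ = addition {δ₁ = δ₁} {δ₂} c≢0 ℓ isZeta₁ δ₁q≡ isζ₂ δ₂q≡ κ≢0 (begin
      ρ₃ * z * κ              ≡⟨ solve 3 (λ ρ z κ → ρ :* z :* κ := ρ :* κ :* z) refl ρ₃ z κ ⟩
      ρ₃ * κ * z              ≡⟨ cong (_* z) ρ₃κ≡ ⟩
      (δ₂ + ρ * δ₁) * z       ≡⟨ solve 4 (λ δ₁ δ₂ ρ z → (δ₂ :+ ρ :* δ₁) :* z :=
                                    con 1ℚ :* z :* δ₂ :+ ρ :* z :* δ₁) refl δ₁ δ₂ ρ z ⟩
      1ℚ * z * δ₂ + ρ * z * δ₁  ∎)
    n = (ν + s * e) * (ν + s * e) - b * (s * (ν + s * e)) + c * (s * s)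
    t≢0 : t ≢ 0ℚ
    t≢0 t≡0 = q₂≢0 (trans q₂≡ttk (trans (cong (λ t → t * t * class k) t≡0)
      (solve 1 (λ k → con 0ℚ :* con 0ℚ :* k := con 0ℚ) refl (class k))))
    q₀t≢0 = p*q≢0 q₀≢0 t≢0
    instance q₀t-nonZero = ≢-nonZero q₀t≢0
    -- Solved from q₀ q₂ q₃ = n² and q₂ = t² `class k`, where q₀ is the product of the two classes.
    t₃ = n ÷ (q X₀ * t)
    t₃q₀t≡n : t₃ * (q X₀ * t) ≡ n
    t₃q₀t≡n = p÷q*q≡p n (q X₀ * t)
    q₃≡ : q X₃ ≡ t₃ * t₃ * class (k ℙ.⁻¹)
    q₃≡ = *-cancelˡ-≢0 (p*q≢0 q₀≢0 q₂≢0) (begin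
      q X₀ * q X₂ * q X₃                 ≡⟨ qqq≡square ℓ ⟩
      n * n                              ≡⟨ cong (λ n → n * n) t₃q₀t≡n ⟨
      t₃ * (q X₀ * t) * (t₃ * (q X₀ * t))
        ≡⟨ solve 3 (λ t₃ q t → t₃ :* (q :* t) :* (t₃ :* (q :* t)) :=
             q :* (t :* t) :* (t₃ :* t₃) :* q) refl t₃ (q X₀) t ⟩
      q X₀ * (t * t) * (t₃ * t₃) * q X₀  ≡⟨ cong (q X₀ * (t * t) * (t₃ * t₃) *_) (q₀≡class k) ⟨
      q X₀ * (t * t) * (t₃ * t₃) * (class (k ℙ.⁻¹) * class k)
        ≡⟨ solve 5 (λ q t t₃ k′ k → q :* (t :* t) :* (t₃ :* t₃) :* (k′ :* k) :=
             q :* (t :* t :* k) :* (t₃ :* t₃ :* k′)) refl (q X₀) t t₃ (class (k ℙ.⁻¹)) (class k) ⟩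
      q X₀ * (t * t * class k) * (t₃ * t₃ * class (k ℙ.⁻¹))
        ≡⟨ cong (λ u → q X₀ * u * (t₃ * t₃ * class (k ℙ.⁻¹))) q₂≡ttk ⟨
      q X₀ * q X₂ * (t₃ * t₃ * class (k ℙ.⁻¹)) ∎)

  Level-step : ∀ {k Q} → Level k Q → Level (k ℙ.⁻¹) (P₀ ⊕ Q)
  Level-step level-𝒪 = Level-P₀
  Level-step {k} (level {x = x₂} {y₂} {on₂} ρ t ρ-k isζ₂ q₂≡ttk) = go (sumView on₀ on₂) isζ₂ q₂≡ttk
    where
    go : ∀ {x y R} .{on} → SumView P₀ (affine x y on) R →
         IsZeta (x - e) y (ρ * z) → q (x - e) ≡ t * t * class k → Level (k ℙ.⁻¹) R
    go (inverse y≡-y₀) isζ _     = subst (λ k → Level (k ℙ.⁻¹) 𝒪) (sym (level-inverse ρ-k isζ y≡-y₀)) level-𝒪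
    go (sum P)         isζ q≡ttk = level-sum {t = t} P ρ-k isζ q≡ttk

  Level-· : ∀ n → Level (ℕ.parity n) (n · P₀)
  Level-· zero    = level-𝒪
  Level-· (suc n) = subst (λ k → Level k (suc n · P₀)) (parity-suc n) (Level-step (Level-· n))
    where
    parity-suc : ∀ n → ℕ.parity n ℙ.⁻¹ ≡ ℕ.parity (suc n)
    parity-suc n = trans (cong ℙ._⁻¹ (sym (ℙ.suc-homo-⁻¹ n))) (ℙ.⁻¹-involutive (ℕ.parity (suc n)))

  -- An affine self-inverse point has y = 0, hence X = ζy = 0: of the three points of order two only
  -- (e , 0) carries a ζ. Odd ρ is impossible since y = ρ z q has no vanishing factor, and even ρ
  -- would give c = t².
  self-inverse⇒𝒪 : ∀ {k Q} → Level k Q → Q ≡ ⊖ Q → Q ≡ 𝒪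
  self-inverse⇒𝒪 level-𝒪 _ = refl
  self-inverse⇒𝒪 (level {k} {x} {y} {on} ρ t ρ-k isζ q≡ttk) Q≡⊖Q = contradiction q≡ttk (impossible k ρ-k)
    where
    open IsZeta isζ
    y≡0 : y ≡ 0ℚ
    y≡0 = self-inverse {on = on} Q≡⊖Q
    X≡0 : x - e ≡ 0ℚ
    X≡0 = p≡r*s∧s≡0⇒p≡0 {r = ρ * z} x≡ζy y≡0
    q≡c : q (x - e) ≡ c
    q≡c = trans (cong q X≡0) (solve 2 (λ b c → con 0ℚ :* con 0ℚ :+ b :* con 0ℚ :+ c :=
         c) refl b c)
    impossible : ∀ k → HasParity k ρ → q (x - e) ≢ t * t * class k
    impossible 0ℙ _     q≡tt = c-nonsquare t (trans (sym (*-identityʳ (t * t))) (trans (sym q≡tt) q≡c))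
    impossible 1ℙ ρ-odd _    = p*q≢0 (p*q≢0 (odd≢0 ρ-odd) z≢0) (q≢0 c≢0 isζ) (trans (sym y≡ζq) y≡0)

  odd-multiple≢𝒪 : ∀ {Q} → Level 1ℙ Q → Q ≢ 𝒪
  odd-multiple≢𝒪 () refl

  even⇒double : ∀ n → ℕ.parity n ≡ 0ℙ → ∃[ m ] m ℕ.+ m ≡ n
  even⇒double zero          _    = 0 , refl
  even⇒double (suc (suc n)) n-even with even⇒double n n-even
  ... | m , m+m≡n = suc m , cong suc (trans (ℕ.+-suc m m) (cong suc m+m≡n))

  n·P₀≢𝒪 : ∀ n → 0 ℕ.< n → n · P₀ ≢ 𝒪
  n·P₀≢𝒪 = <-rec _ λ n smaller 0<n nP₀≡𝒪 → halve n smaller 0<n nP₀≡𝒪 (ℕ.parity n) refl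
    where
    halve : ∀ n → (∀ {m} → m ℕ.< n → 0 ℕ.< m → m · P₀ ≢ 𝒪) → 0 ℕ.< n → n · P₀ ≡ 𝒪 →
            ∀ k → ¬ ℕ.parity n ≡ k
    halve n _ _ nP₀≡𝒪 1ℙ n-odd = odd-multiple≢𝒪 (subst (λ k → Level k (n · P₀)) n-odd (Level-· n)) nP₀≡𝒪
    halve n smaller 0<n nP₀≡𝒪 0ℙ n-even with even⇒double n n-even
    ... | zero    , refl = contradiction 0<n λ ()
    ... | suc m-1 , refl = smaller (ℕ.m<m+n m ℕ.z<s) ℕ.z<s
      (self-inverse⇒𝒪 (Level-· m) (·-complement P₀ nP₀≡𝒪 m m refl))
      where m = suc m-1

  level-odd⇒offAxis : ∀ {Q} → Level 1ℙ Q → OffAxis Q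
  level-odd⇒offAxis (level ρ t ρ-odd isζ _) = offAxis λ y≡0 →
    p*q≢0 (p*q≢0 (odd≢0 ρ-odd) z≢0) (q≢0 c≢0 isζ) (trans (sym (IsZeta.y≡ζq isζ)) y≡0)

  nonTorsion : NonTorsion P₀
  nonTorsion = record
    { infinite-order = λ n → n·P₀≢𝒪 (suc n) ℕ.z<s
    ; odd-multiples  = λ n → level-odd⇒offAxis (Level-step
        (subst (λ k → Level k ((n ℕ.+ n) · P₀)) (trans (ℙ.+-homo-+ n n) (ℙ.p+p≡0ℙ (ℕ.parity n)))
          (Level-· (n ℕ.+ n))))
    }

-- The choice of the root e.

module Scale {a x₀ y₀ : ℚ} (a≢0 : a ≢ 0ℚ) (y₀≢0 : y₀ ≢ 0ℚ)
             (on₀ : y₀ * y₀ ≡ x₀ * x₀ * x₀ - a * a * x₀) where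
  instance
    a-nonZero  = ≢-nonZero a≢0
    y₀-nonZero = ≢-nonZero y₀≢0

  u : ℚ
  u = x₀ ÷ a

  ua≡x₀ : u * a ≡ x₀
  ua≡x₀ = p÷q*q≡p x₀ a

  z : ℚ → ℚ
  z ε = (x₀ - ε * a) ÷ y₀

  zy₀≡ : ∀ ε → z ε * y₀ ≡ x₀ - ε * a
  zy₀≡ ε = p÷q*q≡p (x₀ - ε * a) y₀

  -- The number Aζ(P₀)² for the root εA, which has to be made even; by `w-equation` it depends on u
  -- and ε alone.
  w : ℚ → ℚ
  w ε = a * (z ε * z ε)

  y₀y₀≡ : y₀ * y₀ ≡ a * a * a * (u * u * u - u)
  y₀y₀≡ = begin
    y₀ * y₀                                   ≡⟨ on₀ ⟩
    x₀ * x₀ * x₀ - a * a * x₀                 ≡⟨ cong (λ x → x * x * x - a * a * x) ua≡x₀ ⟨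
    u * a * (u * a) * (u * a) - a * a * (u * a)
      ≡⟨ solve 2 (λ u a → u :* a :* (u :* a) :* (u :* a) :- a :* a :* (u :* a) :=
           a :* a :* a :* (u :* u :* u :- u)) refl u a ⟩
    a * a * a * (u * u * u - u)               ∎

  w-equation : ∀ ε → w ε * (u * u * u - u) ≡ (u - ε) * (u - ε)
  w-equation ε = *-cancelˡ-≢0 (p*q≢0 (p*q≢0 a≢0 a≢0) a≢0) (begin
    a * a * a * (w ε * (u * u * u - u))
      ≡⟨ solve 3 (λ a w v → a :* w :* v := w :* (a :* v)) refl (a * a) a (w ε * (u * u * u - u)) ⟩
    a * (a * a * (w ε * (u * u * u - u)))
      ≡⟨ solve 3 (λ a w v → a :* (a :* a :* (w :* v)) :=
           w :* (a :* a :* a :* v)) refl a (w ε) (u * u * u - u) ⟩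
    w ε * (a * a * a * (u * u * u - u))
      ≡⟨ cong (w ε *_) y₀y₀≡ ⟨
    w ε * (y₀ * y₀)
      ≡⟨ solve 3 (λ a z y → a :* (z :* z) :* (y :* y) :=
           a :* (z :* y :* (z :* y))) refl a (z ε) y₀ ⟩
    a * (z ε * y₀ * (z ε * y₀))
      ≡⟨ cong (λ t → a * (t * t)) (zy₀≡ ε) ⟩
    a * ((x₀ - ε * a) * (x₀ - ε * a))
      ≡⟨ cong (λ x → a * ((x - ε * a) * (x - ε * a))) ua≡x₀ ⟨
    a * ((u * a - ε * a) * (u * a - ε * a))
      ≡⟨ solve 3 (λ u a ε → a :* ((u :* a :- ε :* a) :* (u :* a :- ε :* a)) :=
           a :* a :* a :* ((u :- ε) :* (u :- ε))) refl u a ε ⟩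
    a * a * a * ((u - ε) * (u - ε)) ∎)

  u³-u≢0 : u * u * u - u ≢ 0ℚ
  u³-u≢0 eq = p*q≢0 y₀≢0 y₀≢0 (p≡r*s∧s≡0⇒p≡0 {r = a * a * a} y₀y₀≡ eq)

  u≢0 : u ≢ 0ℚ
  u≢0 u≡0 = u³-u≢0 (cong (λ u → u * u * u - u) u≡0)

  w0-equation : w 0ℚ * (u * u - 1ℚ) ≡ u
  w0-equation = *-cancelˡ-≢0 u≢0 (begin
    u * (w 0ℚ * (u * u - 1ℚ))
      ≡⟨ solve 2 (λ u w → u :* (w :* (u :* u :- con 1ℚ)) :=
           w :* (u :* u :* u :- u)) refl u (w 0ℚ) ⟩
    w 0ℚ * (u * u * u - u)      ≡⟨ w-equation 0ℚ ⟩
    (u - 0ℚ) * (u - 0ℚ)         ≡⟨ cong (λ v → v * v) (+-identityʳ u) ⟩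
    u * u                       ∎)

  -- Here u³ - u = u (u - ε)(u + ε), so one factor u - ε cancels from `w-equation`.
  w±-equation : ∀ {ε} → ε * ε ≡ 1ℚ → w ε * (u * (u + ε)) ≡ u - ε
  w±-equation {ε} εε≡1 = *-cancelˡ-≢0 u-ε≢0 (begin
    (u - ε) * (w ε * (u * (u + ε)))
      ≡⟨ solve 3 (λ u ε w → (u :- ε) :* (w :* (u :* (u :+ ε))) :=
           w :* (u :* u :* u :- ε :* ε :* u)) refl u ε (w ε) ⟩
    w ε * (u * u * u - ε * ε * u)   ≡⟨ cong (λ k → w ε * (u * u * u - k)) εεu≡u ⟩
    w ε * (u * u * u - u)           ≡⟨ w-equation ε ⟩
    (u - ε) * (u - ε)               ∎)
    where
    εεu≡u : ε * ε * u ≡ u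
    εεu≡u = trans (cong (_* u) εε≡1) (*-identityˡ u)
    u-ε≢0 : u - ε ≢ 0ℚ
    u-ε≢0 eq = u³-u≢0 (begin
      u * u * u - u           ≡⟨ cong (λ v → u * u * u - v) εεu≡u ⟨
      u * u * u - ε * ε * u
        ≡⟨ solve 2 (λ u ε → u :* u :* u :- ε :* ε :* u := u :* (u :+ ε) :* (u :- ε)) refl u ε ⟩
      u * (u + ε) * (u - ε)   ≡⟨ cong (u * (u + ε) *_) eq ⟩
      u * (u + ε) * 0ℚ        ≡⟨ *-zeroʳ (u * (u + ε)) ⟩
      0ℚ                      ∎)

  c-nonsquare-0 : ∀ t → t * t ≢ (0ℚ * 0ℚ + 0ℚ * 0ℚ + 0ℚ * 0ℚ - 1ℚ) * (a * a)
  c-nonsquare-0 t tt≡c = sum-of-squares≢0 t a≢0 (begin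
    t * t + a * a                   ≡⟨ cong (_+ a * a) tt≡c ⟩
    - 1ℚ * (a * a) + a * a
      ≡⟨ solve 1 (λ a → con (- 1ℚ) :* a :+ a := con 0ℚ) refl (a * a) ⟩
    0ℚ                              ∎)

  c-nonsquare-± : ∀ t → t * t ≢ (1ℚ + 1ℚ) * (a * a)
  c-nonsquare-± t tt≡c = 2≢square (t ÷ a) (*-cancelˡ-≢0 (p*q≢0 a≢0 a≢0) (begin
    a * a * (t ÷ a * (t ÷ a))
      ≡⟨ solve 2 (λ a s → a :* a :* (s :* s) := s :* a :* (s :* a)) refl a (t ÷ a) ⟩
    t ÷ a * a * (t ÷ a * a)     ≡⟨ cong (λ s → s * s) (p÷q*q≡p t a) ⟩
    t * t                       ≡⟨ tt≡c ⟩
    (1ℚ + 1ℚ) * (a * a)              ≡⟨ *-comm (1ℚ + 1ℚ) (a * a) ⟩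
    (a * a) * (1ℚ + 1ℚ)              ∎))

  -- The root e = εA: ε = 0 unless u is a 2-adic unit 1 + 2h; then ε = 1 or - 1
  -- according to whether h is even or odd.
  data Choice : Set where
    choice₀ : HasParity 0ℙ (w 0ℚ) → Choice
    choice₊ : HasParity 0ℙ (w 1ℚ) → Choice
    choice₋ : HasParity 0ℙ (w (- 1ℚ)) → Choice

  choice : Choice
  choice with integral⊎inverse-even u
  ... | inj₁ (0ℙ , u-even) = choice₀ (hasParity-÷odd u-even
    (hasParity-- (hasParity-* u-even u-even) hasParity-1) w0-equation)
  -- In terms of r = 1 / u, the value u / (u² - 1) is r / (1 - r²).
  ... | inj₂ (r , ur≡1 , r-even) = choice₀ (hasParity-÷odd r-even
    (hasParity-- hasParity-1 (hasParity-* r-even r-even)) (begin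
      w 0ℚ * (1ℚ - r * r)                     ≡⟨ cong (λ k → w 0ℚ * (k * k - r * r)) ur≡1 ⟨
      w 0ℚ * (u * r * (u * r) - r * r)
        ≡⟨ solve 3 (λ w u r → w :* (u :* r :* (u :* r) :- r :* r) :=
             w :* (u :* u :- con 1ℚ) :* r :* r) refl (w 0ℚ) u r ⟩
      w 0ℚ * (u * u - 1ℚ) * r * r             ≡⟨ cong (λ k → k * r * r) w0-equation ⟩
      u * r * r                               ≡⟨ cong (_* r) ur≡1 ⟩
      1ℚ * r                                  ≡⟨ *-identityˡ r ⟩
      r                                       ∎))
  ... | inj₁ (1ℙ , u-odd) = by-half (half (hasParity-- u-odd hasParity-1))
    where
    by-half : (∃₂ λ π h → HasParity π h × u - 1ℚ ≡ h + h) → Choice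
    -- With u = 1 + 2h, (u - 1) / (u (u + 1)) = h / (u (1 + h)): even over odd.
    by-half (0ℙ , h , h-even , u-1≡2h) = choice₊ (hasParity-÷odd h-even
      (hasParity-* u-odd (hasParity-+ hasParity-1 h-even))
      (*-cancelˡ-≢0 {1ℚ + 1ℚ} (λ ()) (begin
        (1ℚ + 1ℚ) * (w 1ℚ * (u * (1ℚ + h)))
          ≡⟨ solve 3 (λ w u h → (con 1ℚ :+ con 1ℚ) :* (w :* (u :* (con 1ℚ :+ h))) :=
               w :* (u :* (h :+ h :+ con 1ℚ :+ con 1ℚ))) refl (w 1ℚ) u h ⟩
        w 1ℚ * (u * (h + h + 1ℚ + 1ℚ))    ≡⟨ cong (λ k → w 1ℚ * (u * (k + 1ℚ + 1ℚ))) u-1≡2h ⟨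
        w 1ℚ * (u * (u - 1ℚ + 1ℚ + 1ℚ))
          ≡⟨ solve 2 (λ w u → w :* (u :* (u :- con 1ℚ :+ con 1ℚ :+ con 1ℚ)) :=
               w :* (u :* (u :+ con 1ℚ))) refl (w 1ℚ) u ⟩
        w 1ℚ * (u * (u + 1ℚ))             ≡⟨ w±-equation refl ⟩
        u - 1ℚ                            ≡⟨ u-1≡2h ⟩
        h + h
          ≡⟨ solve 1 (λ h → h :+ h := (con 1ℚ :+ con 1ℚ) :* h) refl h ⟩
        (1ℚ + 1ℚ) * h                     ∎)))
    -- With u = 1 + 2h, (u + 1) / (u (u - 1)) = (1 + h) / (u h): again even over odd.
    by-half (1ℙ , h , h-odd , u-1≡2h) = choice₋ (hasParity-÷odd (hasParity-+ hasParity-1 h-odd)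
      (hasParity-* u-odd h-odd)
      (*-cancelˡ-≢0 {1ℚ + 1ℚ} (λ ()) (begin
        (1ℚ + 1ℚ) * (w (- 1ℚ) * (u * h))
          ≡⟨ solve 3 (λ w u h → (con 1ℚ :+ con 1ℚ) :* (w :* (u :* h)) :=
               w :* (u :* (h :+ h))) refl (w (- 1ℚ)) u h ⟩
        w (- 1ℚ) * (u * (h + h))          ≡⟨ cong (λ k → w (- 1ℚ) * (u * k)) u-1≡2h ⟨
        w (- 1ℚ) * (u * (u - 1ℚ))         ≡⟨ w±-equation refl ⟩
        u - - 1ℚ
          ≡⟨ solve 1 (λ u → u :- con (- 1ℚ) := u :- con 1ℚ :+ con 1ℚ :+ con 1ℚ) refl u ⟩
        u - 1ℚ + 1ℚ + 1ℚ                  ≡⟨ cong (λ k → k + 1ℚ + 1ℚ) u-1≡2h ⟩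
        h + h + 1ℚ + 1ℚ
          ≡⟨ solve 1 (λ h → h :+ h :+ con 1ℚ :+ con 1ℚ :=
               (con 1ℚ :+ con 1ℚ) :* (con 1ℚ :+ h)) refl h ⟩
        (1ℚ + 1ℚ) * (1ℚ + h)              ∎)))

-- Pythagorean triples

module Triple {a x y : ℚ} (a-positive : Positive a) (y≢0 : y ≢ 0ℚ)
              (on : y * y ≡ x * x * x - a * a * x) where
  instance y-nonZero = ≢-nonZero y≢0

  a≢0 : a ≢ 0ℚ
  a≢0 a≡0 = <-irrefl (sym a≡0) (positive⁻¹ a {{a-positive}})

  leg₁ leg₂ hypotenuse : ℚ
  leg₁       = (x * x - a * a) ÷ y
  leg₂       = ((a + a) * x) ÷ y
  hypotenuse = (x * x + a * a) ÷ y

  leg₁*y : leg₁ * y ≡ x * x - a * a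
  leg₁*y = p÷q*q≡p _ y

  leg₂*y : leg₂ * y ≡ (a + a) * x
  leg₂*y = p÷q*q≡p _ y

  hypotenuse*y : hypotenuse * y ≡ x * x + a * a
  hypotenuse*y = p÷q*q≡p _ y

  yy≡x[xx-aa] : y * y ≡ x * (x * x - a * a)
  yy≡x[xx-aa] = trans on (solve 2 (λ x a → x :* x :* x :- a :* a :* x :=
       x :* (x :* x :- a :* a)) refl x a)

  x≢0 : x ≢ 0ℚ
  x≢0 x≡0 = p*q≢0 y≢0 y≢0 (trans yy≡x[xx-aa] (trans (cong (_* (x * x - a * a)) x≡0) (*-zeroˡ (x * x - a * a))))

  leg₁≢0 : leg₁ ≢ 0ℚ
  leg₁≢0 leg₁≡0 = p*q≢0 y≢0 y≢0 (p≡r*s∧s≡0⇒p≡0 {r = x} yy≡x[xx-aa]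
    (trans (sym leg₁*y) (trans (cong (_* y) leg₁≡0) (*-zeroˡ y))))

  2a≢0 : a + a ≢ 0ℚ
  2a≢0 eq = p*q≢0 {1ℚ + 1ℚ} {a} (λ ()) a≢0
    (trans (solve 1 (λ a → (con 1ℚ :+ con 1ℚ) :* a := a :+ a) refl a) eq)

  leg₂≢0 : leg₂ ≢ 0ℚ
  leg₂≢0 leg₂≡0 = p*q≢0 2a≢0 x≢0 (trans (sym leg₂*y) (trans (cong (_* y) leg₂≡0) (*-zeroˡ y)))

  hypotenuse≢0 : hypotenuse ≢ 0ℚ
  hypotenuse≢0 hypotenuse≡0 = sum-of-squares≢0 x a≢0
    (trans (sym hypotenuse*y) (trans (cong (_* y) hypotenuse≡0) (*-zeroˡ y)))

  pythagoras : leg₁ * leg₁ + leg₂ * leg₂ ≡ hypotenuse * hypotenuse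
  pythagoras = *-cancelˡ-≢0 (p*q≢0 y≢0 y≢0) (begin
    y * y * (leg₁ * leg₁ + leg₂ * leg₂)
      ≡⟨ solve 3 (λ y p q → y :* y :* (p :* p :+ q :* q) :=
           p :* y :* (p :* y) :+ q :* y :* (q :* y)) refl y leg₁ leg₂ ⟩
    leg₁ * y * (leg₁ * y) + leg₂ * y * (leg₂ * y)
      ≡⟨ cong₂ (λ u v → u * u + v * v) leg₁*y leg₂*y ⟩
    (x * x - a * a) * (x * x - a * a) + (a + a) * x * ((a + a) * x)
      ≡⟨ solve 2 (λ x a → (x :* x :- a :* a) :* (x :* x :- a :* a) :+ (a :+ a) :* x :* ((a :+ a) :* x) :=
           (x :* x :+ a :* a) :* (x :* x :+ a :* a)) refl x a ⟩
    (x * x + a * a) * (x * x + a * a)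
      ≡⟨ cong (λ u → u * u) hypotenuse*y ⟨
    hypotenuse * y * (hypotenuse * y)
      ≡⟨ solve 2 (λ y p → p :* y :* (p :* y) := y :* y :* (p :* p)) refl y hypotenuse ⟩
    y * y * (hypotenuse * hypotenuse) ∎)

  area : leg₁ * leg₂ * ½ ≡ a
  area = *-cancelˡ-≢0 (p*q≢0 y≢0 y≢0) (begin
    y * y * (leg₁ * leg₂ * ½)
      ≡⟨ solve 3 (λ y p q → y :* y :* (p :* q :* con ½) :=
           p :* y :* (q :* y) :* con ½) refl y leg₁ leg₂ ⟩
    leg₁ * y * (leg₂ * y) * ½
      ≡⟨ cong₂ (λ u v → u * v * ½) leg₁*y leg₂*y ⟩
    (x * x - a * a) * ((a + a) * x) * ½
      ≡⟨ solve 2 (λ x a → (x :* x :- a :* a) :* ((a :+ a) :* x) :* con ½ :=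
           x :* (x :* x :- a :* a) :* a) refl x a ⟩
    x * (x * x - a * a) * a
      ≡⟨ cong (_* a) yy≡x[xx-aa] ⟨
    y * y * a ∎)

  -- This inverts the passage from points to triples: x is recovered as a (leg₁ + hypotenuse) /
  -- leg₂.
  x*leg₂ : leg₂ * x ≡ a * (leg₁ + hypotenuse)
  x*leg₂ = *-cancelˡ-≢0 y≢0 (begin
    y * (leg₂ * x)
      ≡⟨ solve 3 (λ y p x → y :* (p :* x) := p :* y :* x) refl y leg₂ x ⟩
    leg₂ * y * x                          ≡⟨ cong (_* x) leg₂*y ⟩
    (a + a) * x * x
      ≡⟨ solve 2 (λ x a → (a :+ a) :* x :* x :=
           a :* (x :* x :- a :* a :+ (x :* x :+ a :* a))) refl x a ⟩
    a * (x * x - a * a + (x * x + a * a)) ≡⟨ cong₂ (λ u v → a * (u + v)) leg₁*y hypotenuse*y ⟨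
    a * (leg₁ * y + hypotenuse * y)
      ≡⟨ solve 4 (λ y a p r → a :* (p :* y :+ r :* y) :=
           y :* (a :* (p :+ r))) refl y a leg₁ hypotenuse ⟩
    y * (a * (leg₁ + hypotenuse))         ∎)

-- The inverse correspondence x = a (p + r) / q, y = 2a² (p + r) / q². The sum p + r is nonzero
-- because q² = (r - p)(r + p).
congruent-point : ∀ {a p q r} → a ≢ 0ℚ → p * p + q * q ≡ r * r → p * q ≢ 0ℚ → p * q * ½ ≡ a →
                  ∃₂ λ x y → y * y ≡ x * x * x - a * a * x × y ≢ 0ℚ
congruent-point {a} {p} {q} {r} a≢0 pp+qq≡rr pq≢0 area = a * k , y , on , y≢0
  where
  q≢0 : q ≢ 0ℚ
  q≢0 q≡0 = pq≢0 (p≡r*s∧s≡0⇒p≡0 {r = p} refl q≡0)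
  instance q-nonZero = ≢-nonZero q≢0
  k y : ℚ
  k = (p + r) ÷ q
  y = ((a * a + a * a) * k) ÷ q
  kq≡ : k * q ≡ p + r
  kq≡ = p÷q*q≡p (p + r) q
  yq≡ : y * q ≡ (a * a + a * a) * k
  yq≡ = p÷q*q≡p ((a * a + a * a) * k) q
  p+r≢0 : p + r ≢ 0ℚ
  p+r≢0 p+r≡0 = p*q≢0 q≢0 q≢0 (begin
    q * q
      ≡⟨ solve 3 (λ p q r → q :* q :=
           p :* p :+ q :* q :- r :* r :- (p :- r) :* (p :+ r)) refl p q r ⟩
    p * p + q * q - r * r - (p - r) * (p + r)
      ≡⟨ cong₂ (λ u v → u - (p - r) * v) (p≡q⇒p-q≡0 pp+qq≡rr) p+r≡0 ⟩
    0ℚ - (p - r) * 0ℚ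
      ≡⟨ solve 1 (λ s → con 0ℚ :- s :* con 0ℚ := con 0ℚ) refl (p - r) ⟩
    0ℚ                                   ∎)
  k≢0 : k ≢ 0ℚ
  k≢0 k≡0 = p+r≢0 (trans (sym kq≡) (trans (cong (_* q) k≡0) (*-zeroˡ q)))
  y≢0 : y ≢ 0ℚ
  y≢0 y≡0 = p*q≢0 (p*q≢0 {1ℚ + 1ℚ} {a * a} (λ ()) (p*q≢0 a≢0 a≢0)) k≢0 (begin
    (1ℚ + 1ℚ) * (a * a) * k
      ≡⟨ solve 2 (λ s k → (con 1ℚ :+ con 1ℚ) :* s :* k := (s :+ s) :* k) refl (a * a) k ⟩
    (a * a + a * a) * k       ≡⟨ yq≡ ⟨
    y * q                     ≡⟨ cong (_* q) y≡0 ⟩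
    0ℚ * q                    ≡⟨ *-zeroˡ q ⟩
    0ℚ                        ∎)
  kkqq-qq : k * q * (k * q) - q * q ≡ (p + p) * (k * q)
  kkqq-qq = begin
    k * q * (k * q) - q * q       ≡⟨ cong (λ s → s * s - q * q) kq≡ ⟩
    (p + r) * (p + r) - q * q
      ≡⟨ solve 3 (λ p q r → (p :+ r) :* (p :+ r) :- q :* q :=
           (p :+ p) :* (p :+ r) :- (p :* p :+ q :* q :- r :* r)) refl p q r ⟩
    (p + p) * (p + r) - (p * p + q * q - r * r)
      ≡⟨ cong₂ (λ s t → (p + p) * s - t) (sym kq≡) (p≡q⇒p-q≡0 pp+qq≡rr) ⟩
    (p + p) * (k * q) - 0ℚ        ≡⟨ +-identityʳ _ ⟩
    (p + p) * (k * q)             ∎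
  on : y * y ≡ a * k * (a * k) * (a * k) - a * a * (a * k)
  on = *-cancelˡ-≢0 (p*q≢0 q≢0 q≢0) (begin
    q * q * (y * y)      ≡⟨ solve 2 (λ q y → q :* q :* (y :* y) := y :* q :* (y :* q)) refl q y ⟩
    y * q * (y * q)      ≡⟨ cong (λ s → s * s) yq≡ ⟩
    (a * a + a * a) * k * ((a * a + a * a) * k)
      ≡⟨ solve 2 (λ a k → (a :* a :+ a :* a) :* k :* ((a :* a :+ a :* a) :* k) :=
           a :* a :* a :* (k :* k) :* con 4ℚ :* a) refl a k ⟩
    a * a * a * (k * k) * 4ℚ * a
      -- One of the factors a is traded for the area pq / 2, which brings in the sides.
      ≡⟨ cong (a * a * a * (k * k) * 4ℚ *_) area ⟨
    a * a * a * (k * k) * 4ℚ * (p * q * ½)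
      ≡⟨ solve 4 (λ a k p q → a :* a :* a :* (k :* k) :* con 4ℚ :* (p :* q :* con ½) :=
           a :* a :* a :* k :* ((p :+ p) :* (k :* q))) refl a k p q ⟩
    a * a * a * k * ((p + p) * (k * q))
      ≡⟨ cong (a * a * a * k *_) kkqq-qq ⟨
    a * a * a * k * (k * q * (k * q) - q * q)
      ≡⟨ solve 3 (λ a k q → a :* a :* a :* k :* (k :* q :* (k :* q) :- q :* q) :=
           q :* q :* (a :* k :* (a :* k) :* (a :* k) :- a :* a :* (a :* k))) refl a k q ⟩
    q * q * (a * k * (a * k) * (a * k) - a * a * (a * k)) ∎)
    where 4ℚ = 1ℚ + 1ℚ + (1ℚ + 1ℚ)

-- Infinite order and the resulting family of triples.

module NonTorsionPoints (A : ℕ) (0<A : 0 ℕ.< A) where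
  open CongruentNumberCurve A

  a : ℚ
  a = fromℕ A

  a-positive : Positive a
  a-positive = normalize-pos A 1 {{_}} {{ℕ.>-nonZero 0<A}}

  a≢0 : a ≢ 0ℚ
  a≢0 a≡0 = <-irrefl (sym a≡0) (positive⁻¹ a {{a-positive}})

  A²≢0 : A² ≢ 0ℚ
  A²≢0 = p*q≢0 a≢0 a≢0

  open GroupLaw A A²≢0

  nonTorsion : ∀ x₀ y₀ (on₀ : OnCurve x₀ y₀) → y₀ ≢ 0ℚ → NonTorsion (affine x₀ y₀ on₀)
  nonTorsion x₀ y₀ on₀ y₀≢0 = by-choice choice
    where
    open Scale {a} {x₀} {y₀} a≢0 y₀≢0 on₀
    by-choice : Choice → NonTorsion (affine x₀ y₀ on₀)
    by-choice (choice₀ w-even) =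
      Descent.nonTorsion A A²≢0 0ℚ refl hasParity-0 c-nonsquare-0 {z = z 0ℚ} on₀ y₀≢0
        (sym (zy₀≡ 0ℚ)) w-even
    by-choice (choice₊ w-even) =
      Descent.nonTorsion A A²≢0 1ℚ refl hasParity-1 c-nonsquare-± {z = z 1ℚ} on₀ y₀≢0
        (sym (zy₀≡ 1ℚ)) w-even
    by-choice (choice₋ w-even) =
      Descent.nonTorsion A A²≢0 (- 1ℚ) refl (hasParity-neg hasParity-1) c-nonsquare-± {z = z (- 1ℚ)} on₀ y₀≢0
        (sym (zy₀≡ (- 1ℚ))) w-even

  triple : ∀ {Q} → OffAxis Q → ℚ × ℚ × ℚ
  triple (offAxis {x} {y} {on} y≢0) = leg₁ , leg₂ , hypotenuse
    where open Triple {a} {x} {y} a-positive y≢0 (recompute-onCurve x y on)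

  triple-pythagorean : ∀ {Q} (o : OffAxis Q) → PythagoreanTriple A (triple o)
  triple-pythagorean (offAxis {x} {y} {on} y≢0) = leg₁≢0 , leg₂≢0 , hypotenuse≢0 , pythagoras ,
    trans (sym (0≤p⇒∣p∣≡p (<⇒≤ (positive⁻¹ a {{a-positive}})))) (cong ∣_∣ (sym area))
    where open Triple {a} {x} {y} a-positive y≢0 (recompute-onCurve x y on)

  -- The sides determine x because leg₂ ≠ 0, and then y because the hypotenuse, a quotient of x² +
  -- a² > 0, is nonzero.
  triple-injective : ∀ {Q R} (o : OffAxis Q) (o′ : OffAxis R) → triple o ≡ triple o′ → Q ≡ R
  triple-injective (offAxis {x} {y} {on} y≢0) (offAxis {x′} {y′} {on′} y′≢0) eq =
    affine-cong on on′ x≡x′ y≡y′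
    where
    module T  = Triple {a} {x} {y} a-positive y≢0 (recompute-onCurve x y on)
    module T′ = Triple {a} {x′} {y′} a-positive y′≢0 (recompute-onCurve x′ y′ on′)
    leg₁≡ : T.leg₁ ≡ T′.leg₁
    leg₁≡ = cong proj₁ eq
    leg₂≡ : T.leg₂ ≡ T′.leg₂
    leg₂≡ = cong (λ t → proj₁ (proj₂ t)) eq
    hypotenuse≡ : T.hypotenuse ≡ T′.hypotenuse
    hypotenuse≡ = cong (λ t → proj₂ (proj₂ t)) eq
    x≡x′ : x ≡ x′
    x≡x′ = *-cancelˡ-≢0 T.leg₂≢0 (begin
      T.leg₂ * x                       ≡⟨ T.x*leg₂ ⟩
      a * (T.leg₁ + T.hypotenuse)      ≡⟨ cong₂ (λ u v → a * (u + v)) leg₁≡ hypotenuse≡ ⟩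
      a * (T′.leg₁ + T′.hypotenuse)    ≡⟨ T′.x*leg₂ ⟨
      T′.leg₂ * x′                     ≡⟨ cong (_* x′) leg₂≡ ⟨
      T.leg₂ * x′                      ∎)
    y≡y′ : y ≡ y′
    y≡y′ = *-cancelˡ-≢0 T.hypotenuse≢0 (begin
      T.hypotenuse * y      ≡⟨ T.hypotenuse*y ⟩
      x * x + a * a         ≡⟨ cong (λ x → x * x + a * a) x≡x′ ⟩
      x′ * x′ + a * a       ≡⟨ T′.hypotenuse*y ⟨
      T′.hypotenuse * y′    ≡⟨ cong (_* y′) hypotenuse≡ ⟨
      T.hypotenuse * y′     ∎)

  module _ {P : Point} (P-nonTorsion : NonTorsion P) where
    open NonTorsion P-nonTorsion

    distinct : ∀ {m n} → m ℕ.< n → n · P ≢ m · P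
    distinct {m} {n} m<n nP≡mP = infinite-order k (·-∸ P m (suc k)
      (trans (cong (_· P) (trans (ℕ.+-suc m k) (ℕ.m+[n∸m]≡n m<n))) nP≡mP))
      -- Chosen so that n = m + suc k, the form in which `infinite-order` counts multiples.
      where k = n ℕ.∸ suc m

    ·-injective : ∀ {m n} → m · P ≡ n · P → m ≡ n
    ·-injective {m} {n} mP≡nP = by-cmp (ℕ.<-cmp m n)
      where
      by-cmp : Tri (m ℕ.< n) (m ≡ n) (n ℕ.< m) → m ≡ n
      by-cmp (tri≈ _ m≡n _) = m≡n
      by-cmp (tri< m<n _ _) = contradiction (sym mP≡nP) (distinct m<n)
      by-cmp (tri> _ _ n<m) = contradiction mP≡nP (distinct n<m)

    m+m-injective : ∀ {m n} → m ℕ.+ m ≡ n ℕ.+ n → m ≡ n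
    m+m-injective {m} {n} eq = ℕ.*-cancelˡ-≡ m n 2
      (trans (cong (m ℕ.+_) (ℕ.+-identityʳ m)) (trans eq (cong (n ℕ.+_) (sym (ℕ.+-identityʳ n)))))

    infinitely-many-triples : Infinite (PythagoreanTriple A)
    infinitely-many-triples = (λ n → triple (odd-multiples n)) ,
      (λ {m} {n} eq → m+m-injective (ℕ.suc-injective (·-injective
        (triple-injective (odd-multiples m) (odd-multiples n) eq)))) ,
      λ n → triple-pythagorean (odd-multiples n)

theorem1 : ∀ (A : ℕ) → IsCongruent A → let open CongruentNumberCurve A in
    (∀ (x₀ y₀ : ℚ) (on : OnCurve x₀ y₀) → y₀ ≢ 0ℚ →
    HasInfiniteOrder rawGroup (affine x₀ y₀ on))
    × (∃ (PythagoreanTriple A) → Infinite (PythagoreanTriple A))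
theorem1 A (0<A , p , q , r , pp+qq≡rr , pq≢0 , area) =
  (λ x₀ y₀ on y₀≢0 → GroupLaw.NonTorsion.infinite-order (nonTorsion x₀ y₀ on y₀≢0)) ,
  λ _ → infinite (congruent-point {p = p} {q} {r} a≢0 pp+qq≡rr pq≢0 area)
  where
  open CongruentNumberCurve A
  open NonTorsionPoints A 0<A
  infinite : (∃₂ λ x y → OnCurve x y × y ≢ 0ℚ) → Infinite (PythagoreanTriple A)
  infinite (x , y , on , y≢0) = infinitely-many-triples (nonTorsion x y on y≢0)
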